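{- Let $\mathbb{F}_q$ be a finite field with $q\equiv -1\pmod 3$. There exist exactly $q-1$ isomorphism classes (over $\mathbb{F}_q$) of elliptic curves $E$ over $\mathbb{F}_q$ such that $\#E(\mathbb{F}_q)$ is a multiple of $3$. A parametrization of these classes (each class occurring exactly once) is given by the family $$\{\,y^2+axy+y=x^3 \;:\; a\in\mathbb{F}_q,\ a\neq 3\,\}.$$ -}

module Defs where

open import Algebra.Apartness.Bundles using (HeytingField)
import Algebra.Apartness.Properties.HeytingCommutativeRing as HeytingProperties
open import Algebra.Bundles using (CommutativeRing)
import Algebra.Properties.Ring as RingProperties
import Algebra.Properties.Semiring.Exp as Exp
import Algebra.Properties.Semiring.Mult as Mult
import Algebra.Solver.Ring as RingSolver
open import Algebra.Solver.Ring.AlmostCommutativeRing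
  using (fromCommutativeRing; _-Raw-AlmostCommutative⟶_; Induced-equivalence)
open import Data.Fin.Base using (Fin)
open import Data.Integer.Base as ℤ using (ℤ; +_; -[1+_]; _⊖_)
import Data.Integer.Properties as ℤ
import Data.Maybe.Relation.Binary.Pointwise as Maybe
open import Data.Maybe.Base using (just; nothing)
open import Data.Nat.Base as ℕ using (ℕ; zero; suc)
open import Data.Nat.Divisibility using (_∣_)
open import Data.Product.Base using (Σ-syntax; ∃-syntax; _×_; _,_; proj₁)
open import Data.Product.Relation.Binary.Pointwise.NonDependent using (×-setoid)
open import Function.Base using (_∘_)
open import Function.Bundles using (Bijection)
open import Level using (_⊔_)
open import Relation.Binary.Bundles using (Setoid)
import Relation.Binary.Construct.On as On
open import Relation.Binary.Definitions using (WeaklyDecidable)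
open import Relation.Binary.PropositionalEquality as ≡ using (_≡_)
import Relation.Binary.Reasoning.Setoid as ≈-Reasoning
open import Relation.Binary.Structures using (IsEquivalence)
open import Relation.Nullary.Decidable.Core using (yes; no)

-- For a setoid, the number of elements is the number of ≈-classes.

HasCardinality : ∀ {a ℓ} → Setoid a ℓ → ℕ → Set (a ⊔ ℓ)
HasCardinality S n = Bijection (≡.setoid (Fin n)) S

-- A ring solver with integer coefficients for an arbitrary commutative
-- ring.  It only serves to show that isomorphism of Weierstrass curves
-- is an equivalence relation.

module IntegerSolver {c ℓ} (R : CommutativeRing c ℓ) where
  open CommutativeRing R
  open Mult semiring using (×-homo-+; ×1-homo-*) renaming (_×_ to _·_)
  open RingProperties ring
  open ≈-Reasoning setoid

  ⟦_⟧ℤ : ℤ → Carrier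
  ⟦ + n ⟧ℤ      = n · 1#
  ⟦ -[1+ n ] ⟧ℤ = - (suc n · 1#)

  private
    ⊖-homo : ∀ m n → ⟦ m ⊖ n ⟧ℤ ≈ m · 1# - n · 1#
    ⊖-homo m       zero    = sym (trans (+-congˡ -0#≈0#) (+-identityʳ _))
    ⊖-homo zero    (suc n) = sym (+-identityˡ _)
    ⊖-homo (suc m) (suc n) = begin
      ⟦ suc m ⊖ suc n ⟧ℤ                    ≡⟨ ≡.cong ⟦_⟧ℤ (ℤ.[1+m]⊖[1+n]≡m⊖n m n) ⟩
      ⟦ m ⊖ n ⟧ℤ                            ≈⟨ ⊖-homo m n ⟩
      m · 1# - n · 1#                       ≈⟨ +-congʳ (xyx⁻¹≈y 1# _) ⟨
      1# + m · 1# - 1# - n · 1#             ≈⟨ +-assoc _ _ _ ⟩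
      1# + m · 1# + (- 1# - n · 1#)         ≈⟨ +-congˡ (-‿+-comm _ _) ⟩
      1# + m · 1# - (1# + n · 1#)           ∎

    neg-homo : ∀ i → ⟦ ℤ.- i ⟧ℤ ≈ - ⟦ i ⟧ℤ
    neg-homo (+ zero)  = sym -0#≈0#
    neg-homo (+ suc n) = refl
    neg-homo -[1+ n ]  = sym (-‿involutive _)

    +-homo : ∀ i j → ⟦ i ℤ.+ j ⟧ℤ ≈ ⟦ i ⟧ℤ + ⟦ j ⟧ℤ
    +-homo (+ m)    (+ n)    = ×-homo-+ 1# m n
    +-homo (+ m)    -[1+ n ] = ⊖-homo m (suc n)
    +-homo -[1+ m ] (+ n)    = trans (⊖-homo n (suc m)) (+-comm _ _)
    +-homo -[1+ m ] -[1+ n ] = begin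
      - (suc (suc (m ℕ.+ n)) · 1#)          ≈⟨ -‿cong (+-congˡ (×-homo-+ 1# (suc m) n)) ⟩
      - (1# + (suc m · 1# + n · 1#))        ≈⟨ -‿cong (+-assoc _ _ _) ⟨
      - (1# + suc m · 1# + n · 1#)          ≈⟨ -‿cong (+-congʳ (+-comm _ _)) ⟩
      - (suc m · 1# + 1# + n · 1#)          ≈⟨ -‿cong (+-assoc _ _ _) ⟩
      - (suc m · 1# + suc n · 1#)           ≈⟨ -‿+-comm _ _ ⟨
      - (suc m · 1#) - suc n · 1#           ∎

    +*-homo : ∀ m j → ⟦ + m ℤ.* j ⟧ℤ ≈ m · 1# * ⟦ j ⟧ℤ
    +*-homo m (+ n) = begin
      ⟦ + m ℤ.* + n ⟧ℤ                      ≡⟨ ≡.cong ⟦_⟧ℤ (ℤ.pos-* m n) ⟨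
      (m ℕ.* n) · 1#                        ≈⟨ ×1-homo-* m n ⟩
      m · 1# * (n · 1#)                     ∎
    +*-homo m -[1+ n ] = begin
      ⟦ + m ℤ.* -[1+ n ] ⟧ℤ                 ≡⟨ ≡.cong ⟦_⟧ℤ (ℤ.neg-distribʳ-* (+ m) (+ suc n)) ⟨
      ⟦ ℤ.- (+ m ℤ.* + suc n) ⟧ℤ            ≈⟨ neg-homo (+ m ℤ.* + suc n) ⟩
      - ⟦ + m ℤ.* + suc n ⟧ℤ                ≈⟨ -‿cong (+*-homo m (+ suc n)) ⟩
      - (m · 1# * (suc n · 1#))             ≈⟨ -‿distribʳ-* _ _ ⟩
      m · 1# * - (suc n · 1#)               ∎

    *-homo : ∀ i j → ⟦ i ℤ.* j ⟧ℤ ≈ ⟦ i ⟧ℤ * ⟦ j ⟧ℤ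
    *-homo (+ m)    j = +*-homo m j
    *-homo -[1+ m ] j = begin
      ⟦ -[1+ m ] ℤ.* j ⟧ℤ                   ≡⟨ ≡.cong ⟦_⟧ℤ (ℤ.neg-distribˡ-* (+ suc m) j) ⟨
      ⟦ ℤ.- (+ suc m ℤ.* j) ⟧ℤ              ≈⟨ neg-homo (+ suc m ℤ.* j) ⟩
      - ⟦ + suc m ℤ.* j ⟧ℤ                  ≈⟨ -‿cong (+*-homo (suc m) j) ⟩
      - (suc m · 1# * ⟦ j ⟧ℤ)               ≈⟨ -‿distribˡ-* _ _ ⟩
      - (suc m · 1#) * ⟦ j ⟧ℤ               ∎

    morphism : ℤ.+-*-rawRing -Raw-AlmostCommutative⟶ fromCommutativeRing R
    morphism = record
      { ⟦_⟧    = ⟦_⟧ℤ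
      ; +-homo = +-homo
      ; *-homo = *-homo
      ; -‿homo = neg-homo
      ; 0-homo = refl
      ; 1-homo = +-identityʳ 1#
      }

    weaklyDecidable : WeaklyDecidable (Induced-equivalence morphism)
    weaklyDecidable i j with i ℤ.≟ j
    ... | yes i≡j = just (reflexive (≡.cong ⟦_⟧ℤ i≡j))
    ... | no  _   = nothing

  open RingSolver ℤ.+-*-rawRing (fromCommutativeRing R) morphism weaklyDecidable public

record WeierstrassCurve {c} (A : Set c) : Set c where
  constructor weierstrass
  field
    a₁ a₂ a₃ a₄ a₆ : A

-- Over a finite field ≈ is decidable, so _#_ is simply the negation
-- of _≈_.

module EllipticCurves {c ℓ₁ ℓ₂} (F : HeytingField c ℓ₁ ℓ₂) where
  open HeytingField F public
    using (Carrier; _≈_; _#_; _+_; _*_; -_; _-_; 0#; 1#; heytingCommutativeRing)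

  commutativeRing : CommutativeRing c ℓ₁
  commutativeRing = record { isCommutativeRing = HeytingField.isCommutativeRing F }

  open CommutativeRing commutativeRing public using (setoid; semiring)

  open Mult semiring public using () renaming (_×_ to _·_)
  open Exp  semiring public using (_^_)

  private
    Curve = WeierstrassCurve Carrier

  infix 4 _≈ᵂ_
  record _≈ᵂ_ (W W′ : Curve) : Set ℓ₁ where
    constructor mk≈ᵂ
    private
      module W  = WeierstrassCurve W
      module W′ = WeierstrassCurve W′
    field
      a₁≈ : W.a₁ ≈ W′.a₁
      a₂≈ : W.a₂ ≈ W′.a₂
      a₃≈ : W.a₃ ≈ W′.a₃
      a₄≈ : W.a₄ ≈ W′.a₄
      a₆≈ : W.a₆ ≈ W′.a₆

  discriminant : Curve → Carrier
  discriminant W =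
    - (b₂ ^ 2 * b₈) - 8 · (b₄ ^ 3) - 27 · (b₆ ^ 2) + 9 · (b₂ * b₄ * b₆)
    where
    open WeierstrassCurve W
    b₂ = a₁ ^ 2 + 4 · a₂
    b₄ = 2 · a₄ + a₁ * a₃
    b₆ = a₃ ^ 2 + 4 · a₆
    b₈ = a₁ ^ 2 * a₆ + 4 · (a₂ * a₆) - a₁ * a₃ * a₄ + a₂ * a₃ ^ 2 - a₄ ^ 2

  record EllipticCurve : Set (c ⊔ ℓ₂) where
    field
      curve        : Curve
      discriminant# : discriminant curve # 0#

  open EllipticCurve public

  OnCurve : Curve → Carrier × Carrier → Set ℓ₁
  OnCurve W (x , y) =
    y ^ 2 + a₁ * x * y + a₃ * y ≈ x ^ 3 + a₂ * x ^ 2 + a₄ * x + a₆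
    where open WeierstrassCurve W

  -- Rational points; `nothing` is the point at infinity.

  points : Curve → Setoid (c ⊔ ℓ₁) (c ⊔ ℓ₁)
  points W = Maybe.setoid
    (On.setoid {B = Σ[ xy ∈ Carrier × Carrier ] OnCurve W xy}
      (×-setoid setoid setoid) proj₁)

  -- The substitution x = x′ + r, y = y′ + s x′ + t turns the equation of
  -- W into that of translate r s t W.

  translate : Carrier → Carrier → Carrier → Curve → Curve
  translate r s t (weierstrass a₁ a₂ a₃ a₄ a₆) = weierstrass
    (a₁ + 2 · s)
    (a₂ - s * a₁ + 3 · r - s ^ 2)
    (a₃ + r * a₁ + 2 · t)
    (a₄ - s * a₃ + 2 · (r * a₂) - (t + r * s) * a₁ + 3 · (r ^ 2) - 2 · (s * t))
    (a₆ + r * a₄ + r ^ 2 * a₂ + r ^ 3 - t * a₃ - t ^ 2 - r * t * a₁)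

  scale : Carrier → Curve → Curve
  scale u (weierstrass a₁ a₂ a₃ a₄ a₆) =
    weierstrass (u * a₁) (u ^ 2 * a₂) (u ^ 3 * a₃) (u ^ 4 * a₄) (u ^ 6 * a₆)

  -- The isomorphisms W′ → W defined over F and preserving the point at
  -- infinity are x = u² x′ + r, y = u³ y′ + s u² x′ + t with u ≠ 0.

  infix 4 _≅_
  _≅_ : Curve → Curve → Set (c ⊔ ℓ₁ ⊔ ℓ₂)
  W ≅ W′ = ∃[ u ] ∃[ r ] ∃[ s ] ∃[ t ]
    (u # 0# × scale u W′ ≈ᵂ translate r s t W)

  private
    open CommutativeRing commutativeRing hiding
      (Carrier; _≈_; _+_; _*_; -_; _-_; 0#; 1#; setoid; semiring)
    open HeytingField F using (#⇒invertible)
    open HeytingProperties heytingCommutativeRing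
      using (1#0; x#0y#0→xy#0; invertibleˡ⇒#; x-0≈x)
    open Mult semiring using (×-congʳ)
    open Exp semiring using (^-congˡ)
    open IntegerSolver commutativeRing

    sub-cong : ∀ {w x y z} → w ≈ x → y ≈ z → w - y ≈ x - z
    sub-cong p q = +-cong p (-‿cong q)

    ≈ᵂ-refl : ∀ {W} → W ≈ᵂ W
    ≈ᵂ-refl = mk≈ᵂ refl refl refl refl refl

    ≈ᵂ-sym : ∀ {W W′} → W ≈ᵂ W′ → W′ ≈ᵂ W
    ≈ᵂ-sym (mk≈ᵂ p₁ p₂ p₃ p₄ p₆) = mk≈ᵂ (sym p₁) (sym p₂) (sym p₃) (sym p₄) (sym p₆)

    ≈ᵂ-trans : ∀ {W W′ W″} → W ≈ᵂ W′ → W′ ≈ᵂ W″ → W ≈ᵂ W″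
    ≈ᵂ-trans (mk≈ᵂ p₁ p₂ p₃ p₄ p₆) (mk≈ᵂ q₁ q₂ q₃ q₄ q₆) =
      mk≈ᵂ (trans p₁ q₁) (trans p₂ q₂) (trans p₃ q₃) (trans p₄ q₄) (trans p₆ q₆)

  ≈ᵂ-setoid : Setoid c ℓ₁
  ≈ᵂ-setoid = record
    { _≈_           = _≈ᵂ_
    ; isEquivalence = record { refl = ≈ᵂ-refl ; sym = ≈ᵂ-sym ; trans = ≈ᵂ-trans }
    }

  private
    open ≈-Reasoning ≈ᵂ-setoid

    scale-cong : ∀ {u v W W′} → u ≈ v → W ≈ᵂ W′ → scale u W ≈ᵂ scale v W′
    scale-cong e (mk≈ᵂ p₁ p₂ p₃ p₄ p₆) = mk≈ᵂ
      (*-cong e p₁) (*-cong (^-congˡ 2 e) p₂) (*-cong (^-congˡ 3 e) p₃)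
      (*-cong (^-congˡ 4 e) p₄) (*-cong (^-congˡ 6 e) p₆)

    translate-cong : ∀ r s t {W W′} → W ≈ᵂ W′ → translate r s t W ≈ᵂ translate r s t W′
    translate-cong r s t (mk≈ᵂ p₁ p₂ p₃ p₄ p₆) = mk≈ᵂ
      (+-congʳ p₁)
      (+-congʳ (+-congʳ (sub-cong p₂ (*-congˡ p₁))))
      (+-congʳ (+-cong p₃ (*-congˡ p₁)))
      (+-congʳ (+-congʳ (sub-cong
        (+-cong (sub-cong p₄ (*-congˡ p₃)) (×-congʳ 2 (*-congˡ p₂)))
        (*-congˡ p₁))))
      (sub-cong
        (+-congʳ (sub-cong (+-congʳ (+-cong (+-cong p₆ (*-congˡ p₄)) (*-congˡ p₂)))
          (*-congˡ p₃)))
        (*-congˡ p₁))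

    infixl 8 _:·_
    _:·_ : ∀ {n} → ℕ → Polynomial n → Polynomial n
    zero  :· p = con (+ 0)
    suc n :· p = p :+ n :· p

    module _ {n} (r s t : Polynomial n) where
      τ₁ : Polynomial n → Polynomial n
      τ₁ a₁ = a₁ :+ 2 :· s

      τ₂ : (a₁ a₂ : Polynomial n) → Polynomial n
      τ₂ a₁ a₂ = a₂ :- s :* a₁ :+ 3 :· r :- s :^ 2

      τ₃ : (a₁ a₃ : Polynomial n) → Polynomial n
      τ₃ a₁ a₃ = a₃ :+ r :* a₁ :+ 2 :· t

      τ₄ : (a₁ a₂ a₃ a₄ : Polynomial n) → Polynomial n
      τ₄ a₁ a₂ a₃ a₄ =
        a₄ :- s :* a₃ :+ 2 :· (r :* a₂) :- (t :+ r :* s) :* a₁ :+ 3 :· (r :^ 2)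
           :- 2 :· (s :* t)

      τ₆ : (a₁ a₂ a₃ a₄ a₆ : Polynomial n) → Polynomial n
      τ₆ a₁ a₂ a₃ a₄ a₆ =
        a₆ :+ r :* a₄ :+ r :^ 2 :* a₂ :+ r :^ 3 :- t :* a₃ :- t :^ 2 :- r :* t :* a₁

    translate-0 : ∀ W → translate 0# 0# 0# W ≈ᵂ W
    translate-0 (weierstrass a₁ a₂ a₃ a₄ a₆) = mk≈ᵂ
      (solve 1 (λ a₁ → τ₁ O O O a₁ := a₁) refl a₁)
      (solve 2 (λ a₁ a₂ → τ₂ O O O a₁ a₂ := a₂) refl a₁ a₂)
      (solve 2 (λ a₁ a₃ → τ₃ O O O a₁ a₃ := a₃) refl a₁ a₃)
      (solve 4 (λ a₁ a₂ a₃ a₄ → τ₄ O O O a₁ a₂ a₃ a₄ := a₄) refl a₁ a₂ a₃ a₄)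
      (solve 5 (λ a₁ a₂ a₃ a₄ a₆ → τ₆ O O O a₁ a₂ a₃ a₄ a₆ := a₆) refl a₁ a₂ a₃ a₄ a₆)
      where
      O : ∀ {n} → Polynomial n
      O = con (+ 0)

    translate-translate : ∀ r s t r′ s′ t′ W →
      translate r′ s′ t′ (translate r s t W)
        ≈ᵂ translate (r + r′) (s + s′) (t + t′ + s * r′) W
    translate-translate r s t r′ s′ t′ (weierstrass a₁ a₂ a₃ a₄ a₆) = mk≈ᵂ
      (solve 7 (λ r s t r′ s′ t′ a₁ →
          τ₁ r′ s′ t′ (τ₁ r s t a₁)
            := τ₁ (r :+ r′) (s :+ s′) (t :+ t′ :+ s :* r′) a₁)
        refl r s t r′ s′ t′ a₁)
      (solve 8 (λ r s t r′ s′ t′ a₁ a₂ →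
          τ₂ r′ s′ t′ (τ₁ r s t a₁) (τ₂ r s t a₁ a₂)
            := τ₂ (r :+ r′) (s :+ s′) (t :+ t′ :+ s :* r′) a₁ a₂)
        refl r s t r′ s′ t′ a₁ a₂)
      (solve 8 (λ r s t r′ s′ t′ a₁ a₃ →
          τ₃ r′ s′ t′ (τ₁ r s t a₁) (τ₃ r s t a₁ a₃)
            := τ₃ (r :+ r′) (s :+ s′) (t :+ t′ :+ s :* r′) a₁ a₃)
        refl r s t r′ s′ t′ a₁ a₃)
      (solve 10 (λ r s t r′ s′ t′ a₁ a₂ a₃ a₄ →
          τ₄ r′ s′ t′ (τ₁ r s t a₁) (τ₂ r s t a₁ a₂) (τ₃ r s t a₁ a₃)
              (τ₄ r s t a₁ a₂ a₃ a₄)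
            := τ₄ (r :+ r′) (s :+ s′) (t :+ t′ :+ s :* r′) a₁ a₂ a₃ a₄)
        refl r s t r′ s′ t′ a₁ a₂ a₃ a₄)
      (solve 11 (λ r s t r′ s′ t′ a₁ a₂ a₃ a₄ a₆ →
          τ₆ r′ s′ t′ (τ₁ r s t a₁) (τ₂ r s t a₁ a₂) (τ₃ r s t a₁ a₃)
              (τ₄ r s t a₁ a₂ a₃ a₄) (τ₆ r s t a₁ a₂ a₃ a₄ a₆)
            := τ₆ (r :+ r′) (s :+ s′) (t :+ t′ :+ s :* r′) a₁ a₂ a₃ a₄ a₆)
        refl r s t r′ s′ t′ a₁ a₂ a₃ a₄ a₆)

    translate-inverse : ∀ r s t W →
      translate (- r) (- s) (s * r - t) (translate r s t W) ≈ᵂ W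
    translate-inverse r s t (weierstrass a₁ a₂ a₃ a₄ a₆) = mk≈ᵂ
      (solve 4 (λ r s t a₁ →
          τ₁ (:- r) (:- s) (s :* r :- t) (τ₁ r s t a₁) := a₁)
        refl r s t a₁)
      (solve 5 (λ r s t a₁ a₂ →
          τ₂ (:- r) (:- s) (s :* r :- t) (τ₁ r s t a₁) (τ₂ r s t a₁ a₂) := a₂)
        refl r s t a₁ a₂)
      (solve 5 (λ r s t a₁ a₃ →
          τ₃ (:- r) (:- s) (s :* r :- t) (τ₁ r s t a₁) (τ₃ r s t a₁ a₃) := a₃)
        refl r s t a₁ a₃)
      (solve 7 (λ r s t a₁ a₂ a₃ a₄ →
          τ₄ (:- r) (:- s) (s :* r :- t) (τ₁ r s t a₁) (τ₂ r s t a₁ a₂)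
              (τ₃ r s t a₁ a₃) (τ₄ r s t a₁ a₂ a₃ a₄)
            := a₄)
        refl r s t a₁ a₂ a₃ a₄)
      (solve 8 (λ r s t a₁ a₂ a₃ a₄ a₆ →
          τ₆ (:- r) (:- s) (s :* r :- t) (τ₁ r s t a₁) (τ₂ r s t a₁ a₂)
              (τ₃ r s t a₁ a₃) (τ₄ r s t a₁ a₂ a₃ a₄) (τ₆ r s t a₁ a₂ a₃ a₄ a₆)
            := a₆)
        refl r s t a₁ a₂ a₃ a₄ a₆)

    scale-translate : ∀ u r s t W →
      scale u (translate r s t W)
        ≈ᵂ translate (u ^ 2 * r) (u * s) (u ^ 3 * t) (scale u W)
    scale-translate u r s t (weierstrass a₁ a₂ a₃ a₄ a₆) = mk≈ᵂ
      (solve 5 (λ u r s t a₁ →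
          u :* τ₁ r s t a₁
            := τ₁ (u :^ 2 :* r) (u :* s) (u :^ 3 :* t) (u :* a₁))
        refl u r s t a₁)
      (solve 6 (λ u r s t a₁ a₂ →
          u :^ 2 :* τ₂ r s t a₁ a₂
            := τ₂ (u :^ 2 :* r) (u :* s) (u :^ 3 :* t) (u :* a₁) (u :^ 2 :* a₂))
        refl u r s t a₁ a₂)
      (solve 6 (λ u r s t a₁ a₃ →
          u :^ 3 :* τ₃ r s t a₁ a₃
            := τ₃ (u :^ 2 :* r) (u :* s) (u :^ 3 :* t) (u :* a₁) (u :^ 3 :* a₃))
        refl u r s t a₁ a₃)
      (solve 8 (λ u r s t a₁ a₂ a₃ a₄ →
          u :^ 4 :* τ₄ r s t a₁ a₂ a₃ a₄
            := τ₄ (u :^ 2 :* r) (u :* s) (u :^ 3 :* t) (u :* a₁) (u :^ 2 :* a₂)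
                 (u :^ 3 :* a₃) (u :^ 4 :* a₄))
        refl u r s t a₁ a₂ a₃ a₄)
      (solve 9 (λ u r s t a₁ a₂ a₃ a₄ a₆ →
          u :^ 6 :* τ₆ r s t a₁ a₂ a₃ a₄ a₆
            := τ₆ (u :^ 2 :* r) (u :* s) (u :^ 3 :* t) (u :* a₁) (u :^ 2 :* a₂)
                 (u :^ 3 :* a₃) (u :^ 4 :* a₄) (u :^ 6 :* a₆))
        refl u r s t a₁ a₂ a₃ a₄ a₆)

    scale-scale : ∀ u v W → scale u (scale v W) ≈ᵂ scale (u * v) W
    scale-scale u v (weierstrass a₁ a₂ a₃ a₄ a₆) = mk≈ᵂ
      (sym (*-assoc u v a₁)) (lemma 2 a₂) (lemma 3 a₃) (lemma 4 a₄) (lemma 6 a₆)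
      where
      open import Algebra.Properties.CommutativeSemiring.Exp commutativeSemiring
        using (^-distrib-*)

      lemma : ∀ n a → u ^ n * (v ^ n * a) ≈ (u * v) ^ n * a
      lemma n a = trans (sym (*-assoc _ _ _)) (*-congʳ (sym (^-distrib-* u v n)))

    scale-1 : ∀ W → scale 1# W ≈ᵂ W
    scale-1 (weierstrass a₁ a₂ a₃ a₄ a₆) = mk≈ᵂ
      (*-identityˡ a₁) (lemma 2 a₂) (lemma 3 a₃) (lemma 4 a₄) (lemma 6 a₆)
      where
      1^n≈1 : ∀ n → 1# ^ n ≈ 1#
      1^n≈1 zero    = refl
      1^n≈1 (suc n) = trans (*-identityˡ _) (1^n≈1 n)

      lemma : ∀ n a → 1# ^ n * a ≈ a
      lemma n a = trans (*-congʳ (1^n≈1 n)) (*-identityˡ a)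

    ≅-refl : ∀ {W} → W ≅ W
    ≅-refl {W} = 1# , 0# , 0# , 0# , 1#0 , ≈ᵂ-trans (scale-1 W) (≈ᵂ-sym (translate-0 W))

    ≅-trans : ∀ {W W′ W″} → W ≅ W′ → W′ ≅ W″ → W ≅ W″
    ≅-trans {W} {W′} {W″} (u , r , s , t , u#0 , p) (v , r′ , s′ , t′ , v#0 , q) =
      u * v , _ , _ , _ , x#0y#0→xy#0 u#0 v#0 , (begin
        scale (u * v) W″                    ≈⟨ scale-scale u v W″ ⟨
        scale u (scale v W″)                ≈⟨ scale-cong refl q ⟩
        scale u (translate r′ s′ t′ W′)     ≈⟨ scale-translate u r′ s′ t′ W′ ⟩
        translate (u ^ 2 * r′) (u * s′) (u ^ 3 * t′) (scale u W′)
                                            ≈⟨ translate-cong _ _ _ p ⟩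
        translate (u ^ 2 * r′) (u * s′) (u ^ 3 * t′) (translate r s t W)
                                            ≈⟨ translate-translate r s t _ _ _ W ⟩
        translate _ _ _ W                   ∎)

    ≅-sym : ∀ {W W′} → W ≅ W′ → W′ ≅ W
    ≅-sym {W} {W′} (u , r , s , t , u#0 , p) with #⇒invertible u#0
    ... | v , v[u-0]≈1 , [u-0]v≈1 = v , _ , _ , _ , v#0 , (begin
      scale v W                             ≈⟨ scale-cong refl (translate-inverse r s t W) ⟨
      scale v (translate r⁻ s⁻ t⁻ (translate r s t W))
                                            ≈⟨ scale-cong refl (translate-cong r⁻ s⁻ t⁻ p) ⟨
      scale v (translate r⁻ s⁻ t⁻ (scale u W′))
                                            ≈⟨ scale-translate v r⁻ s⁻ t⁻ _ ⟩
      translate _ _ _ (scale v (scale u W′))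
                                            ≈⟨ translate-cong _ _ _ (scale-scale v u W′) ⟩
      translate _ _ _ (scale (v * u) W′)    ≈⟨ translate-cong _ _ _ (scale-cong vu≈1 ≈ᵂ-refl) ⟩
      translate _ _ _ (scale 1# W′)         ≈⟨ translate-cong _ _ _ (scale-1 W′) ⟩
      translate (v ^ 2 * r⁻) (v * s⁻) (v ^ 3 * t⁻) W′ ∎)
      where
      r⁻ = - r
      s⁻ = - s
      t⁻ = s * r - t

      vu≈1 : v * u ≈ 1#
      vu≈1 = trans (*-congˡ (sym (x-0≈x u))) v[u-0]≈1

      v#0 : v # 0#
      v#0 = invertibleˡ⇒# (u , trans (*-congˡ (x-0≈x v)) (trans (*-comm u v) vu≈1))

  ≅-isEquivalence : IsEquivalence _≅_
  ≅-isEquivalence = record { refl = ≅-refl ; sym = ≅-sym ; trans = ≅-trans }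

  isoSetoid : Setoid c (c ⊔ ℓ₁ ⊔ ℓ₂)
  isoSetoid = record { isEquivalence = ≅-isEquivalence }

  OrderDivisibleBy : ℕ → EllipticCurve → Set (c ⊔ ℓ₁)
  OrderDivisibleBy m E = ∃[ n ] (HasCardinality (points (curve E)) n × m ∣ n)

  isomorphismClasses : ∀ {p} → (EllipticCurve → Set p) → Setoid (c ⊔ ℓ₂ ⊔ p) (c ⊔ ℓ₁ ⊔ ℓ₂)
  isomorphismClasses P =
    On.setoid {B = Σ[ E ∈ EllipticCurve ] P E} isoSetoid (curve ∘ proj₁)

  elementsApartFrom : Carrier → Setoid (c ⊔ ℓ₂) ℓ₁
  elementsApartFrom b = On.setoid {B = Σ[ a ∈ Carrier ] a # b} setoid proj₁

  -- y² + a x y + y = x³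

  family : Carrier → Curve
  family a = weierstrass a 0# 1# 0# 0#

{-# OPTIONS --safe #-}

-- If P, Q and R = P ∙ Q are the intersections of a line with E, then
-- (P , Q) ↦ (Q , R) permutes E(F) × E(F) with period three and fixes exactly
-- the pairs (P , P) with P a flex.  Hence #E(F)² is congruent mod 3 to the
-- number of rational flexes, and when 3 ∣ #E(F) there is one besides the
-- point at infinity; no group law is needed.  Moving it to (0 , 0), with its
-- tangent along y = 0, brings the curve to y² + A x y + B y = x³, and as
-- cubing is a bijection of F when q ≡ −1 mod 3, scaling makes B = 1.
-- Conversely (0 , 0) has order three on every curve of the family, and
-- translation by it is (x , y) ↦ (−y/x² , −y/x³), which is free of period
-- three when a ≠ 3.  Finally the affine rational flexes of such a curve are
-- (0 , 0) and (0 , −1), so an isomorphism permutes them and preserves a.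
module Submission where

open import Defs
open import Algebra.Apartness.Bundles using (HeytingField)
import Algebra.Apartness.Properties.HeytingCommutativeRing as HeytingProperties
open import Algebra.Bundles using (CommutativeRing)
import Algebra.Properties.Group as GroupProperties
import Algebra.Properties.Semiring.Exp as Exp
import Algebra.Properties.Semiring.Mult as Mult
open import Data.Empty using (⊥-elim)
open import Data.Fin.Base as Fin using (Fin; zero; suc; punchIn; punchOut)
open import Data.Fin.Permutation using (permutation)
import Data.Fin.Properties as Fin
import Data.Integer.Base as ℤ
open import Data.List.Base using (List; _∷_; length; lookup; deduplicate; tabulate)
open import Data.List.Membership.Propositional.Properties using (∈-lookup)
import Data.List.Membership.Setoid as Membership
open import Data.List.Membership.Setoid.Properties using (∈-deduplicate⁺)
import Data.List.Relation.Unary.All as All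
open import Data.List.Relation.Unary.AllPairs using (_∷_)
open import Data.List.Relation.Unary.Any using (here; there; index)
open import Data.List.Relation.Unary.Any.Properties using (lookup-index; tabulate⁺)
open import Data.List.Relation.Unary.Unique.DecSetoid.Properties using (deduplicate-!)
import Data.List.Relation.Unary.Unique.Setoid as Unique
open import Data.Maybe.Base using (just; nothing)
open import Data.Maybe.Relation.Binary.Pointwise as Maybe using (just; nothing)
open import Data.Nat.Base as ℕ using (ℕ; zero; suc)
open import Data.Nat.Divisibility
  using (_∣_; divides; _∣?_; ∣m+n∣m⇒∣n; n∣m*n; ∣n⇒∣m*n)
import Data.Nat.Properties as ℕ
open import Algebra.Properties.CommutativeMonoid.Sum ℕ.+-0-commutativeMonoid
  using (sum; sum-cong-≗; sum-permute; ∑-distrib-+)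
open import Data.Product.Base using (Σ-syntax; ∃-syntax; _×_; _,_; proj₁; proj₂; map₂)
open import Data.Product.Relation.Binary.Pointwise.NonDependent using (×-setoid; ×-decidable)
open import Function.Base using (_∘_)
open import Function.Bundles using (Bijection)
import Function.Construct.Composition as Composition
open import Level using (Level; _⊔_)
open import Relation.Binary.Bundles using (Setoid; DecSetoid)
open import Relation.Binary.Definitions using (tri<; tri≈; tri>; _Respects_)
open import Relation.Binary.PropositionalEquality as ≡ using (_≡_; _≢_)
open import Relation.Nullary.Decidable as Dec
  using (Dec; yes; no; from-no; ¬?; _×-dec_)
open import Relation.Nullary.Negation using (¬_; contradiction)

private variable
  a p ℓ : Level

-- Counting the orbits of a map of order three on `Fin n`.

indicator : {A : Set a} → Dec A → ℕ
indicator (yes _) = 1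
indicator (no _)  = 0

indicator-yes : {A : Set a} (A? : Dec A) → A → indicator A? ≡ 1
indicator-yes (yes _) _ = ≡.refl
indicator-yes (no ¬x) x = contradiction x ¬x

indicator-no : {A : Set a} (A? : Dec A) → ¬ A → indicator A? ≡ 0
indicator-no (yes x) ¬x = contradiction x ¬x
indicator-no (no _)  _  = ≡.refl

sum-ones : ∀ n → sum {n} (λ _ → 1) ≡ n
sum-ones zero    = ≡.refl
sum-ones (suc n) = ≡.cong suc (sum-ones n)

sum-zeros : ∀ n → sum {n} (λ _ → 0) ≡ 0
sum-zeros zero    = ≡.refl
sum-zeros (suc n) = sum-zeros n

sum-indicator-≡ : ∀ {n} (i : Fin n) → sum (λ j → indicator (j Fin.≟ i)) ≡ 1
sum-indicator-≡ {suc n} zero    = ≡.cong suc (sum-zeros n)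
sum-indicator-≡ {suc n} (suc i) = ≡.trans (sum-cong-≗ lemma) (sum-indicator-≡ i)
  where
  lemma : ∀ j → indicator (suc j Fin.≟ suc i) ≡ indicator (j Fin.≟ i)
  lemma j with j Fin.≟ i
  ... | yes _ = ≡.refl
  ... | no  _ = ≡.refl

module FinOrderThree {n} (f : Fin n → Fin n) (f³≗id : ∀ i → f (f (f i)) ≡ i) where
  open import Data.Nat.Base using (_+_; _*_)

  private
    least : (i j k : Fin n) → ℕ
    least i j k = indicator (i Fin.<? j ×-dec i Fin.<? k)

    least-yes : ∀ i j k → i Fin.< j → i Fin.< k → least i j k ≡ 1
    least-yes i j k p q = indicator-yes (i Fin.<? j ×-dec i Fin.<? k) (p , q)

    least-noˡ : ∀ i j k → j Fin.< i → least i j k ≡ 0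
    least-noˡ i j k j<i =
      indicator-no (i Fin.<? j ×-dec i Fin.<? k) λ (i<j , _) → Fin.<-asym i<j j<i

    least-noʳ : ∀ i j k → k Fin.< i → least i j k ≡ 0
    least-noʳ i j k k<i =
      indicator-no (i Fin.<? j ×-dec i Fin.<? k) λ (_ , i<k) → Fin.<-asym i<k k<i

    -- The smaller of `i` and `j` is compared with `k`, so the impossible cyclic orderings never
    -- have to be refuted.
    one-least : ∀ {i j k} → i ≢ j → j ≢ k → k ≢ i →
      least i j k + (least j k i + least k i j) ≡ 1
    one-least {i} {j} {k} i≢j j≢k k≢i with Fin.<-cmp i j | Fin.<-cmp j k | Fin.<-cmp k i
    ... | tri≈ _ i≡j _ | _            | _            = contradiction i≡j i≢j
    ... | _            | tri≈ _ j≡k _ | _            = contradiction j≡k j≢k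
    ... | _            | _            | tri≈ _ k≡i _ = contradiction k≡i k≢i
    ... | tri< i<j _ _ | _            | tri> _ _ i<k =
      ≡.cong₂ _+_ (least-yes i j k i<j i<k) (≡.cong₂ _+_ (least-noʳ j k i i<j) (least-noˡ k i j i<k))
    ... | tri< i<j _ _ | _            | tri< k<i _ _ =
      ≡.cong₂ _+_ (least-noʳ i j k k<i)
        (≡.cong₂ _+_ (least-noʳ j k i i<j) (least-yes k i j k<i (Fin.<-trans k<i i<j)))
    ... | tri> _ _ j<i | tri< j<k _ _ | _            =
      ≡.cong₂ _+_ (least-noˡ i j k j<i) (≡.cong₂ _+_ (least-yes j k i j<k j<i) (least-noʳ k i j j<k))
    ... | tri> _ _ j<i | tri> _ _ k<j | _            =
      ≡.cong₂ _+_ (least-noˡ i j k j<i)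
        (≡.cong₂ _+_ (least-noˡ j k i k<j) (least-yes k i j (Fin.<-trans k<j j<i) k<j))

    w : Fin n → ℕ
    w i = least i (f i) (f (f i))

    fixed : Fin n → ℕ
    fixed i = indicator (f i Fin.≟ i)

    w-fixed : ∀ {i} → f i ≡ i → w i ≡ 0
    w-fixed {i} fi≡i = indicator-no (i Fin.<? f i ×-dec i Fin.<? f (f i))
      λ (i<fi , _) → Fin.<-irrefl (≡.sym fi≡i) i<fi

    -- Along an orbit of length three exactly one of the three weights is 1; a fixed point has
    -- weight 0 and counts through `fixed`. Summed over `i`, each weight occurs three times because
    -- `f` permutes the indices.
    one : ∀ i → w i + (w (f i) + w (f (f i))) + fixed i ≡ 1
    one i with f i Fin.≟ i
    ... | yes fi≡i = ≡.cong (_+ 1) (≡.cong₂ _+_ (w-fixed fi≡i)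
      (≡.cong₂ _+_ (w-fixed (≡.cong f fi≡i)) (w-fixed (≡.cong (f ∘ f) fi≡i))))
    -- The rewriting turns the three weights into the cyclic rotations that `one-least` adds up.
    ... | no  fi≢i rewrite f³≗id i = ≡.trans (ℕ.+-identityʳ _)
      (one-least (fi≢i ∘ ≡.sym)
        (λ fi≡ffi → fi≢i (≡.trans (≡.cong f (≡.sym (f³≗id i)))
          (≡.trans (≡.sym (≡.cong (f ∘ f) fi≡ffi)) (f³≗id i))))
        (λ ffi≡i → fi≢i (≡.trans (≡.cong f (≡.sym ffi≡i)) (f³≗id i))))

    sum-∘f : ∀ (g : Fin n → ℕ) → sum (g ∘ f) ≡ sum g
    sum-∘f g = ≡.sym (sum-permute g (permutation f (f ∘ f) f³≗id f³≗id))

  -- Every orbit of length three is counted at its least element.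
  orbits : ∃[ m ] n ≡ m * 3 + sum fixed
  orbits = sum w , (begin
    n                                                  ≡⟨ sum-ones n ⟨
    sum {n} (λ _ → 1)                                  ≡⟨ sum-cong-≗ one ⟨
    sum (λ i → w i + (w (f i) + w (f (f i))) + fixed i)
      ≡⟨ ∑-distrib-+ (λ i → w i + (w (f i) + w (f (f i)))) fixed ⟩
    sum (λ i → w i + (w (f i) + w (f (f i)))) + sum fixed
      ≡⟨ ≡.cong (_+ sum fixed) lemma ⟩
    sum w * 3 + sum fixed ∎)
    where
    open ≡.≡-Reasoning
    lemma : sum (λ i → w i + (w (f i) + w (f (f i)))) ≡ sum w * 3
    lemma = begin
      sum (λ i → w i + (w (f i) + w (f (f i)))) ≡⟨ ∑-distrib-+ w (λ i → w (f i) + w (f (f i))) ⟩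
      sum w + sum (λ i → w (f i) + w (f (f i)))
        ≡⟨ ≡.cong (sum w +_) (∑-distrib-+ (w ∘ f) (w ∘ f ∘ f)) ⟩
      sum w + (sum (w ∘ f) + sum (w ∘ f ∘ f))
        ≡⟨ ≡.cong (sum w +_) (≡.cong₂ _+_ (sum-∘f w) (≡.trans (sum-∘f (w ∘ f)) (sum-∘f w))) ⟩
      sum w + (sum w + sum w) ≡⟨ ≡.cong (λ k → sum w + (sum w + k)) (ℕ.+-identityʳ _) ⟨
      3 * sum w               ≡⟨ ℕ.*-comm 3 (sum w) ⟩
      sum w * 3               ∎

  no-fixed : (∀ i → f i ≢ i) → 3 ∣ n
  no-fixed ¬fix with orbits
  ... | m , n≡ = divides m (≡.trans n≡ (≡.trans (≡.cong (m * 3 +_)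
    (≡.trans (sum-cong-≗ λ i → indicator-no (f i Fin.≟ i) (¬fix i)) (sum-zeros n)))
    (ℕ.+-identityʳ _)))

  one-fixed : ∀ j → f j ≡ j → (∀ i → f i ≡ i → i ≡ j) → ∃[ m ] n ≡ m * 3 + 1
  one-fixed j fj≡j unique = map₂ (λ {m} n≡ → ≡.trans n≡ (≡.cong (m * 3 +_)
    (≡.trans (sum-cong-≗ lemma) (sum-indicator-≡ j)))) orbits
    where
    lemma : ∀ i → fixed i ≡ indicator (i Fin.≟ j)
    lemma i with f i Fin.≟ i | i Fin.≟ j
    ... | yes _    | yes _   = ≡.refl
    ... | no _     | no _    = ≡.refl
    ... | yes fi≡i | no i≢j  = contradiction (unique i fi≡i) i≢j
    ... | no fi≢i  | yes ≡.refl = contradiction fj≡j fi≢i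

-- Finite setoids: exhaustive search, pigeonhole, products and enumerations.

module Finite {S : Setoid a ℓ} {n} (card : HasCardinality S n) where
  open Setoid S
  open Bijection card using (to; injective; to⁻; strictlySurjective)

  from : Carrier → Fin n
  from = to⁻

  to-from : ∀ x → to (from x) ≈ x
  to-from x = proj₂ (strictlySurjective x)

  from-cong : ∀ {x y} → x ≈ y → from x ≡ from y
  from-cong {x} {y} x≈y = injective (trans (to-from x) (trans x≈y (sym (to-from y))))

  from-to : ∀ i → from (to i) ≡ i
  from-to i = injective (to-from (to i))

  from-injective : ∀ {x y} → from x ≡ from y → x ≈ y
  from-injective {x} {y} e =
    trans (sym (to-from x)) (trans (reflexive (≡.cong to e)) (to-from y))

  infix 4 _≟_
  _≟_ : ∀ x y → Dec (x ≈ y)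
  x ≟ y = Dec.map′ from-injective from-cong (from x Fin.≟ from y)

  -- Existence is settled constructively by running through the enumeration; this later supplies
  -- inverses, cube roots and flexes.
  any? : {P : Carrier → Set p} → P Respects _≈_ → (∀ x → Dec (P x)) → Dec (∃[ x ] P x)
  any? resp P? = Dec.map′ (λ (i , p) → to i , p)
    (λ (x , p) → from x , resp (sym (to-from x)) p) (Fin.any? (P? ∘ to))

  module OrderThree (σ : Carrier → Carrier) (σ-cong : ∀ {x y} → x ≈ y → σ x ≈ σ y)
    (σ³≈id : ∀ x → σ (σ (σ x)) ≈ x) where
    private
      f : Fin n → Fin n
      f = from ∘ σ ∘ to

      f-cubed : ∀ i → f (f (f i)) ≡ i
      f-cubed i = ≡.trans
        (from-cong (trans (σ-cong (trans (to-from _) (σ-cong (to-from _)))) (σ³≈id (to i))))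
        (from-to i)

      module F = FinOrderThree f f-cubed

      fixed⁻ : ∀ {i} → f i ≡ i → σ (to i) ≈ to i
      fixed⁻ e = trans (sym (to-from _)) (reflexive (≡.cong to e))

    no-fixed : (∀ x → ¬ σ x ≈ x) → 3 ∣ n
    no-fixed ¬fix = F.no-fixed λ i → ¬fix (to i) ∘ fixed⁻

    one-fixed : ∀ p → σ p ≈ p → (∀ x → σ x ≈ x → x ≈ p) → ∃[ m ] n ≡ m ℕ.* 3 ℕ.+ 1
    one-fixed p fix unique = F.one-fixed (from p)
      (from-cong (trans (σ-cong (to-from p)) fix))
      (λ i e → ≡.trans (≡.sym (from-to i)) (from-cong (unique (to i) (fixed⁻ e))))

  -- Pigeonhole: if `y` were missed, deleting its index from the codomain would inject `Fin n` into
  -- a set with one element fewer.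
  injective⇒surjective : (g : Carrier → Carrier) → (∀ {x y} → x ≈ y → g x ≈ g y) →
    (∀ {x y} → g x ≈ g y → x ≈ y) → ∀ y → ∃[ x ] g x ≈ y
  injective⇒surjective g g-cong g-inj y with any? {P = λ x → g x ≈ y}
    (λ x≈x′ e → trans (g-cong (sym x≈x′)) e) (λ x → g x ≟ y)
  ... | yes hit = hit
  ... | no ¬hit = ⊥-elim (miss (from y) h h-inj h≢)
    where
    h : Fin n → Fin n
    h = from ∘ g ∘ to
    h-inj : ∀ {i j} → h i ≡ h j → i ≡ j
    h-inj = injective ∘ g-inj ∘ from-injective
    h≢ : ∀ i → from y ≢ h i
    h≢ i e = ¬hit (to i , sym (from-injective e))
    miss : ∀ {n} (j : Fin n) (h : Fin n → Fin n) → (∀ {i i′} → h i ≡ h i′ → i ≡ i′) →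
      ¬ (∀ i → j ≢ h i)
    miss {suc n} j h h-inj j≢ =
      Fin.<⇒notInjective {f = λ i → punchOut (j≢ i)} (ℕ.n<1+n n)
        λ {i} {i′} e → h-inj (Fin.punchOut-injective (j≢ i) (j≢ i′) e)

×-hasCardinality : ∀ {b ℓ₁ ℓ₂} {S : Setoid a ℓ₁} {T : Setoid b ℓ₂} {m n} →
  HasCardinality S m → HasCardinality T n → HasCardinality (×-setoid S T) (m ℕ.* n)
×-hasCardinality {S = S} {T} {m} {n} cardˢ cardᵗ = record
  { to        = to
  ; cong      = λ { ≡.refl → Setoid.refl (×-setoid S T) }
  ; bijective = injective , λ (x , y) → Fin.combine (S.from x) (T.from y) , λ { ≡.refl →
      Setoid.trans (×-setoid S T)
        (Setoid.reflexive (×-setoid S T) (≡.cong (λ (i , j) → Bˢ.to i , Bᵗ.to j)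
          (Fin.remQuot-combine (S.from x) (T.from y))))
        (S.to-from x , T.to-from y) }
  }
  where
  module Bˢ = Bijection cardˢ
  module Bᵗ = Bijection cardᵗ
  module S  = Finite cardˢ
  module T  = Finite cardᵗ

  to : Fin (m ℕ.* n) → _
  to k = let i , j = Fin.remQuot {m} n k in Bˢ.to i , Bᵗ.to j

  injective : ∀ {k l} → Setoid._≈_ (×-setoid S T) (to k) (to l) → k ≡ l
  injective {k} {l} (p , q) = begin
    k ≡⟨ Fin.combine-remQuot {m} n k ⟨
    _ ≡⟨ ≡.cong₂ Fin.combine (Bˢ.injective p) (Bᵗ.injective q) ⟩
    _ ≡⟨ Fin.combine-remQuot {m} n l ⟩
    l ∎
    where open ≡.≡-Reasoning

module _ (S : DecSetoid a ℓ) where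
  open DecSetoid S using (Carrier; _≈_; _≟_; setoid; sym; trans; reflexive)
  open Membership setoid using (_∈_)
  open Unique setoid using (Unique)

  private
    lookup-injective : ∀ {xs} → Unique xs → ∀ {i j} → lookup xs i ≈ lookup xs j → i ≡ j
    lookup-injective (_ ∷ _)  {zero}  {zero}  _ = ≡.refl
    lookup-injective (ps ∷ _) {zero}  {suc j} e = contradiction e (All.lookup ps (∈-lookup j))
    lookup-injective (ps ∷ _) {suc i} {zero}  e = contradiction (sym e) (All.lookup ps (∈-lookup i))
    lookup-injective (_ ∷ u)  {suc i} {suc j} e = ≡.cong suc (lookup-injective u e)

  -- The list may repeat elements. Once duplicates are removed, its positions are the required
  -- bijection, so no count has to be known beforehand.
  enumerated⇒finite : ∀ xs → (∀ x → x ∈ xs) → ∃[ n ] HasCardinality setoid n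
  enumerated⇒finite xs complete = length ys , record
    { to        = lookup ys
    ; cong      = λ { ≡.refl → reflexive ≡.refl }
    ; bijective = lookup-injective (deduplicate-! S xs)
      , λ y → index (∈ys y) , λ { ≡.refl → sym (lookup-index (∈ys y)) }
    }
    where
    ys : List Carrier
    ys = deduplicate _≟_ xs
    ∈ys : ∀ x → x ∈ ys
    ∈ys x = ∈-deduplicate⁺ setoid _≟_ (λ p q → trans q (sym p)) (complete x)

-- Equational reasoning in a field.

module FieldAlgebra {c ℓ₁ ℓ₂} (F : HeytingField c ℓ₁ ℓ₂) where
  open EllipticCurves F public
  open CommutativeRing commutativeRing public hiding
    (Carrier; _≈_; _+_; _*_; -_; _-_; 0#; 1#; setoid; semiring)
  open HeytingField F public using (#⇒invertible; #-irrefl; tight)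
  open HeytingProperties heytingCommutativeRing public
    using (1#0; invertibleˡ⇒#; x-0≈x)
  open IntegerSolver commutativeRing public
  open GroupProperties +-group public using () renaming
    (x≈y⇒x∙y⁻¹≈ε to x≈y⇒x-y≈0; x∙y⁻¹≈ε⇒x≈y to x-y≈0⇒x≈y)
  open Mult semiring public using (×-congʳ)
  open Exp  semiring public using (^-congˡ)

  infixr 9 _:·_
  _:·_ : ∀ {n} → ℕ → Polynomial n → Polynomial n
  zero  :· p = con (ℤ.+ 0)
  suc n :· p = p :+ n :· p

  -- `con (ℤ.+ 1)` would evaluate to `1# + 0#`; the zeroth power evaluates to `1#` itself, so that
  -- solved identities match the goals literally.
  :0 :1 : ∀ {n} → Polynomial n
  :0 = con (ℤ.+ 0)
  :1 = :0 :^ 0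

  infixl 6 _⊕_
  infixl 7 _⊛_
  -- A hypothesis scaled by a coefficient, as a vanishing difference. Joined by `_⊕_`, such terms
  -- mirror the linear combination on the right-hand side given to the solver.
  _⊛_ : ∀ {x y} k → x ≈ y → k * (x - y) ≈ 0#
  k ⊛ x≈y = trans (*-congˡ (x≈y⇒x-y≈0 x≈y)) (zeroʳ k)

  _⊕_ : ∀ {x y} → x ≈ 0# → y ≈ 0# → x + y ≈ 0#
  x≈0 ⊕ y≈0 = trans (+-cong x≈0 y≈0) (+-identityʳ 0#)

  -- To deduce an equation from others, write the difference of its sides
  -- as a linear combination of the differences of theirs.
  combine : ∀ {x y z} → x - y ≈ z → z ≈ 0# → x ≈ y
  combine p q = x-y≈0⇒x≈y _ _ (trans p q)

  1≉0 : ¬ 1# ≈ 0#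
  1≉0 1≈0 = #-irrefl 1≈0 1#0

-- Finite fields: inverses and cancellation.

module FiniteField {c ℓ₁ ℓ₂} (F : HeytingField c ℓ₁ ℓ₂) {q}
  (card : HasCardinality (EllipticCurves.setoid F) q) where
  open FieldAlgebra F public
  open Finite card public

  #⇒≉ : ∀ {x y} → x # y → ¬ x ≈ y
  #⇒≉ x#y x≈y = #-irrefl x≈y x#y

  -- The field axioms invert only elements apart from zero. An inverse is therefore searched for,
  -- and a failed search would make `x` not apart from zero, hence zero by tightness.
  inverse : ∀ {x} → ¬ x ≈ 0# → ∃[ y ] y * x ≈ 1#
  inverse {x} x≉0 with any? {P = λ y → y * x ≈ 1#}
    (λ y≈z e → trans (*-congʳ (sym y≈z)) e) (λ y → y * x ≟ 1#)
  ... | yes inv = inv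
  ... | no ¬inv = contradiction (proj₁ (tight x 0#) λ x#0 →
    let y , y[x-0]≈1 , _ = #⇒invertible x#0
    in ¬inv (y , trans (*-congˡ (sym (x-0≈x x))) y[x-0]≈1)) x≉0

  ≉⇒# : ∀ {x y} → ¬ x ≈ y → x # y
  ≉⇒# {x} {y} x≉y = invertibleˡ⇒# (inverse (x≉y ∘ x-y≈0⇒x≈y x y))

  x*y≈0⇒y≈0 : ∀ {x y} → ¬ x ≈ 0# → x * y ≈ 0# → y ≈ 0#
  x*y≈0⇒y≈0 {x} {y} x≉0 xy≈0 =
    let z , zx≈1 = inverse x≉0 in combine
      (solve 3 (λ x y z → y :- :0 := z :* (x :* y :- :0) :+ (:- y) :* (z :* x :- :1)) refl x y z)
      (z ⊛ xy≈0 ⊕ (- y) ⊛ zx≈1)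

  *-cancelˡ : ∀ {x y z} → ¬ x ≈ 0# → x * y ≈ x * z → y ≈ z
  *-cancelˡ {x} {y} {z} x≉0 xy≈xz = x-y≈0⇒x≈y y z (x*y≈0⇒y≈0 x≉0 (combine
    (solve 3 (λ x y z → x :* (y :- z) :- :0 := :1 :* (x :* y :- x :* z)) refl x y z)
    (1# ⊛ xy≈xz)))

  x^n≈0⇒x≈0 : ∀ n {x} → x ^ n ≈ 0# → x ≈ 0#
  x^n≈0⇒x≈0 zero    1≈0 = contradiction 1≈0 1≉0
  x^n≈0⇒x≈0 (suc n) {x} e with x ≟ 0#
  ... | yes x≈0 = x≈0
  ... | no  x≉0 = x^n≈0⇒x≈0 n (x*y≈0⇒y≈0 x≉0 e)

  elementsApartFrom-hasCardinality : ∀ b → HasCardinality (elementsApartFrom b) (q ℕ.∸ 1)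
  elementsApartFrom-hasCardinality b = lemma card
    where
    lemma : ∀ {q} → HasCardinality setoid q → HasCardinality (elementsApartFrom b) (q ℕ.∸ 1)
    -- The field contains `b`, so its cardinality is a successor and the truncated subtraction is
    -- exact.
    lemma {zero}  card₀ = contradiction (Finite.from card₀ b) λ ()
    lemma {suc n} card₁ = record
      { to        = λ i → B.to (punchIn j i)
                        , ≉⇒# λ e → Fin.punchInᵢ≢i j i (≡.trans (≡.sym (C.from-to _)) (C.from-cong e))
      ; cong      = λ { ≡.refl → refl }
      ; bijective = Fin.punchIn-injective j _ _ ∘ B.injective
        , λ (x , x#b) → let j≢ = λ j≡ → #⇒≉ x#b (C.from-injective (≡.sym j≡)) in
            punchOut {i = j} {C.from x} j≢ , λ { ≡.refl →
              trans (reflexive (≡.cong B.to (Fin.punchIn-punchOut j≢))) (C.to-from x) }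
      }
      where
      module B = Bijection card₁
      module C = Finite card₁
      j : Fin (suc n)
      j = C.from b

-- Fields with q ≡ -1 mod 3: cubing is bijective.

module Field≡2mod3 {c ℓ₁ ℓ₂} (F : HeytingField c ℓ₁ ℓ₂) {q}
  (card : HasCardinality (EllipticCurves.setoid F) q) (3∣q+1 : 3 ∣ q ℕ.+ 1) where
  open FiniteField F card public

  -- In characteristic three, adding 1 would be free of period three, so 3 would divide `q` as well
  -- as `q + 1`.
  3≉0 : ¬ 3 · 1# ≈ 0#
  3≉0 3≈0 = from-no (3 ∣? 1) (∣m+n∣m⇒∣n 3∣q+1 (Shift.no-fixed λ x x+1≈x → 1≉0 (combine
    (solve 1 (λ x → :1 :- :0 := :1 :* (x :+ :1 :- x)) refl x) (1# ⊛ x+1≈x))))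
    where
    module Shift = OrderThree (_+ 1#) +-congʳ (λ x → combine
      (solve 1 (λ x → x :+ :1 :+ :1 :+ :1 :- x := :1 :* (3 :· :1 :- :0)) refl x)
      (1# ⊛ 3≈0))

  -- A nontrivial cube root of unity would act on F with period three and
  -- fix 0 only, giving q ≡ 1 mod 3.
  ³-injective : ∀ {x y} → x ^ 3 ≈ y ^ 3 → x ≈ y
  ³-injective {x} {y} x³≈y³ with y ≟ 0#
  ... | yes y≈0 = trans (x^n≈0⇒x≈0 3 (trans x³≈y³ (trans (^-congˡ 3 y≈0) (zeroˡ _)))) (sym y≈0)
  ... | no  y≉0 with inverse y≉0
  ...   | z , zy≈1 with x * z ≟ 1#
  ...     | yes xz≈1 = combine
    (solve 3 (λ x y z → x :- y := y :* (x :* z :- :1) :+ (:- x) :* (z :* y :- :1)) refl x y z)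
    (y ⊛ xz≈1 ⊕ (- x) ⊛ zy≈1)
  ...     | no  xz≉1 = contradiction 3∣q+1 (¬3∣ (Rotate.one-fixed 0# (zeroʳ _) λ w xzw≈w →
      x*y≈0⇒y≈0 (xz≉1 ∘ x-y≈0⇒x≈y _ _) (combine
        (solve 2 (λ v w → (v :- :1) :* w :- :0 := :1 :* (v :* w :- w)) refl (x * z) w)
        (1# ⊛ xzw≈w))))
    where
    ¬3∣ : ∃[ m ] q ≡ m ℕ.* 3 ℕ.+ 1 → ¬ 3 ∣ q ℕ.+ 1
    ¬3∣ (m , ≡.refl) d = from-no (3 ∣? 2) (∣m+n∣m⇒∣n (≡.subst (3 ∣_) (ℕ.+-assoc (m ℕ.* 3) 1 1) d) (n∣m*n m))

    module Rotate = OrderThree (x * z *_) *-congˡ (λ w → combine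
      (solve 4 (λ x y z w →
          x :* z :* (x :* z :* (x :* z :* w)) :- w
            := w :* z :^ 3 :* (x :^ 3 :- y :^ 3)
               :+ w :* (z :^ 2 :* y :^ 2 :+ z :* y :+ :1) :* (z :* y :- :1))
        refl x y z w)
      (w * z ^ 3 ⊛ x³≈y³ ⊕ w * (z ^ 2 * y ^ 2 + z * y + 1#) ⊛ zy≈1))

  ³-surjective : ∀ y → ∃[ x ] x ^ 3 ≈ y
  ³-surjective = injective⇒surjective (_^ 3) (^-congˡ 3) ³-injective

-- The discriminant under translation and for special curves.

module Discriminant {c ℓ₁ ℓ₂} (F : HeytingField c ℓ₁ ℓ₂) where
  open FieldAlgebra F

  private
    Curve = WeierstrassCurve Carrier

    Δ : (b₂ b₄ b₆ b₈ : Carrier) → Carrier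
    Δ b₂ b₄ b₆ b₈ = - (b₂ ^ 2 * b₈) - 8 · (b₄ ^ 3) - 27 · (b₆ ^ 2) + 9 · (b₂ * b₄ * b₆)

    Δ-cong : ∀ {b₂ b₄ b₆ b₈ b₂′ b₄′ b₆′ b₈′} → b₂ ≈ b₂′ → b₄ ≈ b₄′ → b₆ ≈ b₆′ → b₈ ≈ b₈′ →
      Δ b₂ b₄ b₆ b₈ ≈ Δ b₂′ b₄′ b₆′ b₈′
    Δ-cong p₂ p₄ p₆ p₈ = +-cong
      (+-cong (+-cong (-‿cong (*-cong (^-congˡ 2 p₂) p₈)) (-‿cong (×-congʳ 8 (^-congˡ 3 p₄))))
        (-‿cong (×-congʳ 27 (^-congˡ 2 p₆))))
      (×-congʳ 9 (*-cong (*-cong p₂ p₄) p₆))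

    :Δ : ∀ {n} (b₂ b₄ b₆ b₈ : Polynomial n) → Polynomial n
    :Δ b₂ b₄ b₆ b₈ =
      :- (b₂ :^ 2 :* b₈) :- 8 :· (b₄ :^ 3) :- 27 :· (b₆ :^ 2) :+ 9 :· (b₂ :* b₄ :* b₆)

    :b₂ : ∀ {n} (a₁ a₂ : Polynomial n) → Polynomial n
    :b₂ a₁ a₂ = a₁ :^ 2 :+ 4 :· a₂

    :b₄ : ∀ {n} (a₁ a₃ a₄ : Polynomial n) → Polynomial n
    :b₄ a₁ a₃ a₄ = 2 :· a₄ :+ a₁ :* a₃

    :b₆ : ∀ {n} (a₃ a₆ : Polynomial n) → Polynomial n
    :b₆ a₃ a₆ = a₃ :^ 2 :+ 4 :· a₆

    :b₈ : ∀ {n} (a₁ a₂ a₃ a₄ a₆ : Polynomial n) → Polynomial n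
    :b₈ a₁ a₂ a₃ a₄ a₆ =
      a₁ :^ 2 :* a₆ :+ 4 :· (a₂ :* a₆) :- a₁ :* a₃ :* a₄ :+ a₂ :* a₃ :^ 2 :- a₄ :^ 2

    module _ {n} (r s t : Polynomial n) where
      τ₁ : Polynomial n → Polynomial n
      τ₁ a₁ = a₁ :+ 2 :· s

      τ₂ : (a₁ a₂ : Polynomial n) → Polynomial n
      τ₂ a₁ a₂ = a₂ :- s :* a₁ :+ 3 :· r :- s :^ 2

      τ₃ : (a₁ a₃ : Polynomial n) → Polynomial n
      τ₃ a₁ a₃ = a₃ :+ r :* a₁ :+ 2 :· t

      τ₄ : (a₁ a₂ a₃ a₄ : Polynomial n) → Polynomial n
      τ₄ a₁ a₂ a₃ a₄ =
        a₄ :- s :* a₃ :+ 2 :· (r :* a₂) :- (t :+ r :* s) :* a₁ :+ 3 :· (r :^ 2)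
           :- 2 :· (s :* t)

      τ₆ : (a₁ a₂ a₃ a₄ a₆ : Polynomial n) → Polynomial n
      τ₆ a₁ a₂ a₃ a₄ a₆ =
        a₆ :+ r :* a₄ :+ r :^ 2 :* a₂ :+ r :^ 3 :- t :* a₃ :- t :^ 2 :- r :* t :* a₁

  discriminant-cong : ∀ {W W′} → W ≈ᵂ W′ → discriminant W ≈ discriminant W′
  discriminant-cong (mk≈ᵂ p₁ p₂ p₃ p₄ p₆) = Δ-cong
    (+-cong (^-congˡ 2 p₁) (×-congʳ 4 p₂))
    (+-cong (×-congʳ 2 p₄) (*-cong p₁ p₃))
    (+-cong (^-congˡ 2 p₃) (×-congʳ 4 p₆))
    (+-cong (+-cong (+-cong (+-cong (*-cong (^-congˡ 2 p₁) p₆) (×-congʳ 4 (*-cong p₂ p₆)))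
      (-‿cong (*-cong (*-cong p₁ p₃) p₄))) (*-cong p₂ (^-congˡ 2 p₃))) (-‿cong (^-congˡ 2 p₄)))

  -- Invariance as a polynomial in the aᵢ, r, s and t is too large for the
  -- solver, so it goes through the bᵢ, where it only holds modulo the
  -- relation 4 b₈ = b₂ b₆ − b₄².
  discriminant-translate : ∀ r s t W → discriminant (translate r s t W) ≈ discriminant W
  discriminant-translate r s t W@(weierstrass a₁ a₂ a₃ a₄ a₆) = trans
    (Δ-cong
      (solve 5 (λ r s t a₁ a₂ →
          :b₂ (τ₁ r s t a₁) (τ₂ r s t a₁ a₂) := :b₂ a₁ a₂ :+ 12 :· r)
        refl r s t a₁ a₂)
      (solve 7 (λ r s t a₁ a₂ a₃ a₄ →
          :b₄ (τ₁ r s t a₁) (τ₃ r s t a₁ a₃) (τ₄ r s t a₁ a₂ a₃ a₄)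
            := :b₄ a₁ a₃ a₄ :+ r :* :b₂ a₁ a₂ :+ 6 :· (r :^ 2))
        refl r s t a₁ a₂ a₃ a₄)
      (solve 8 (λ r s t a₁ a₂ a₃ a₄ a₆ →
          :b₆ (τ₃ r s t a₁ a₃) (τ₆ r s t a₁ a₂ a₃ a₄ a₆)
            := :b₆ a₃ a₆ :+ 2 :· (r :* :b₄ a₁ a₃ a₄) :+ r :^ 2 :* :b₂ a₁ a₂ :+ 4 :· (r :^ 3))
        refl r s t a₁ a₂ a₃ a₄ a₆)
      (solve 8 (λ r s t a₁ a₂ a₃ a₄ a₆ →
          :b₈ (τ₁ r s t a₁) (τ₂ r s t a₁ a₂) (τ₃ r s t a₁ a₃) (τ₄ r s t a₁ a₂ a₃ a₄)
              (τ₆ r s t a₁ a₂ a₃ a₄ a₆)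
            := :b₈ a₁ a₂ a₃ a₄ a₆ :+ 3 :· (r :* :b₆ a₃ a₆) :+ 3 :· (r :^ 2 :* :b₄ a₁ a₃ a₄)
               :+ r :^ 3 :* :b₂ a₁ a₂ :+ 3 :· (r :^ 4))
        refl r s t a₁ a₂ a₃ a₄ a₆))
    (combine
      (solve 5 (λ r b₂ b₄ b₆ b₈ →
          :Δ (b₂ :+ 12 :· r)
             (b₄ :+ r :* b₂ :+ 6 :· (r :^ 2))
             (b₆ :+ 2 :· (r :* b₄) :+ r :^ 2 :* b₂ :+ 4 :· (r :^ 3))
             (b₈ :+ 3 :· (r :* b₆) :+ 3 :· (r :^ 2 :* b₄) :+ r :^ 3 :* b₂ :+ 3 :· (r :^ 4))
          :- :Δ b₂ b₄ b₆ b₈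
            := :- (6 :· (r :* b₂) :+ 36 :· (r :^ 2)) :* (4 :· b₈ :- (b₂ :* b₆ :- b₄ :^ 2)))
        refl r _ _ _ _)
      (- (6 · (r * _) + 36 · (r ^ 2)) ⊛ solve 5 (λ a₁ a₂ a₃ a₄ a₆ →
          4 :· :b₈ a₁ a₂ a₃ a₄ a₆
            := :b₂ a₁ a₂ :* :b₆ a₃ a₆ :- :b₄ a₁ a₃ a₄ :^ 2)
        refl a₁ a₂ a₃ a₄ a₆))

  -- The two factors carry the two conditions on the normal form with a flex at the origin: `b` is
  -- nonzero and, once `b` is 1, `a` differs from 3 because cubing is injective.
  discriminant-flex-at-0 : ∀ a b → discriminant (weierstrass a 0# b 0# 0#) ≈ b ^ 3 * (a ^ 3 - 27 · b)
  discriminant-flex-at-0 = solve 2 (λ a b →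
    :Δ (:b₂ a :0) (:b₄ a b :0) (:b₆ b :0) (:b₈ a :0 b :0 :0) := b :^ 3 :* (a :^ 3 :- 27 :· b)) refl

  discriminant-singular-at-0 : ∀ a₁ a₂ → discriminant (weierstrass a₁ a₂ 0# 0# 0#) ≈ 0#
  discriminant-singular-at-0 = solve 2 (λ a₁ a₂ →
    :Δ (:b₂ a₁ a₂) (:b₄ a₁ :0 :0) (:b₆ :0 :0) (:b₈ a₁ a₂ :0 :0 :0) := :0) refl

-- Chords, tangents and flexes on a Weierstrass curve.

module ChordTangent {c ℓ₁ ℓ₂} (F : HeytingField c ℓ₁ ℓ₂) {q}
  (card : HasCardinality (EllipticCurves.setoid F) q)
  (W : WeierstrassCurve (HeytingField.Carrier F)) where
  open FiniteField F card
  open Discriminant F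
  open WeierstrassCurve W
  module Points = Setoid (points W)
  open Points using () renaming (Carrier to Point; _≈_ to _≈ᴾ_)

  AffinePoint : Set (c ⊔ ℓ₁)
  AffinePoint = Σ[ xy ∈ Carrier × Carrier ] OnCurve W xy

  -- The signs are opposite: `∂y` differentiates left minus right side of the equation, `∂x` right
  -- minus left. The tangent slope is thus the quotient of `∂x` by `∂y`.
  ∂x ∂y : Carrier → Carrier → Carrier
  ∂x x y = 3 · (x ^ 2) + 2 · (a₂ * x) + a₄ - a₁ * y
  ∂y x y = 2 · y + a₁ * x + a₃

  private
    :∂x : ∀ {n} (a₁ a₂ a₄ x y : Polynomial n) → Polynomial n
    :∂x a₁ a₂ a₄ x y = 3 :· (x :^ 2) :+ 2 :· (a₂ :* x) :+ a₄ :- a₁ :* y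

    :∂y : ∀ {n} (a₁ a₃ x y : Polynomial n) → Polynomial n
    :∂y a₁ a₃ x y = 2 :· y :+ a₁ :* x :+ a₃

    :lhs : ∀ {n} (a₁ a₃ x y : Polynomial n) → Polynomial n
    :lhs a₁ a₃ x y = y :^ 2 :+ a₁ :* x :* y :+ a₃ :* y

    :rhs : ∀ {n} (a₂ a₄ a₆ x : Polynomial n) → Polynomial n
    :rhs a₂ a₄ a₆ x = x :^ 3 :+ a₂ :* x :^ 2 :+ a₄ :* x :+ a₆

  -- Moving the point to the origin turns `a₃`, `a₄` and `a₆` into `∂y`, `∂x` and minus the defect
  -- of the equation, all of which vanish.
  singular⇒discriminant≈0 : ∀ {x y} → OnCurve W (x , y) → ∂x x y ≈ 0# → ∂y x y ≈ 0# →
    discriminant W ≈ 0#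
  singular⇒discriminant≈0 {x} {y} on ∂x≈0 ∂y≈0 = trans
    (sym (discriminant-translate x 0# y W))
    (trans (discriminant-cong (mk≈ᵂ refl refl
      (combine
        (solve 4 (λ a₁ a₃ x y → a₃ :+ x :* a₁ :+ 2 :· y :- :0 := :1 :* (:∂y a₁ a₃ x y :- :0))
          refl a₁ a₃ x y)
        (1# ⊛ ∂y≈0))
      (combine
        (solve 6 (λ a₁ a₂ a₃ a₄ x y →
          a₄ :- :0 :* a₃ :+ 2 :· (x :* a₂) :- (y :+ x :* :0) :* a₁ :+ 3 :· (x :^ 2)
             :- 2 :· (:0 :* y) :- :0
          := :1 :* (:∂x a₁ a₂ a₄ x y :- :0))
          refl a₁ a₂ a₃ a₄ x y)
        (1# ⊛ ∂x≈0))
      (combine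
        (solve 7 (λ a₁ a₂ a₃ a₄ a₆ x y →
          a₆ :+ x :* a₄ :+ x :^ 2 :* a₂ :+ x :^ 3 :- y :* a₃ :- y :^ 2 :- x :* y :* a₁ :- :0
          := (:- :1) :* (:lhs a₁ a₃ x y :- :rhs a₂ a₄ a₆ x))
          refl a₁ a₂ a₃ a₄ a₆ x y)
        (- 1# ⊛ on))))
    (discriminant-singular-at-0 _ _))

  -- The restriction of the curve equation to y = m x + b has the roots
  -- x₁, x₂ and x₃ with multiplicity.
  record Chord (P Q R : Carrier × Carrier) : Set (c ⊔ ℓ₁) where
    constructor mkChord
    private
      x₁ = proj₁ P
      x₂ = proj₁ Q
      x₃ = proj₁ R
    field
      m b : Carrier
      P∈  : proj₂ P ≈ m * x₁ + b
      Q∈  : proj₂ Q ≈ m * x₂ + b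
      R∈  : proj₂ R ≈ m * x₃ + b
      e₁  : x₁ + x₂ + x₃ ≈ m ^ 2 + a₁ * m - a₂
      e₂  : x₁ * x₂ + x₂ * x₃ + x₃ * x₁ ≈ a₄ - 2 · (m * b) - a₁ * b - a₃ * m
      e₃  : x₁ * x₂ * x₃ ≈ b ^ 2 + a₃ * b - a₆

  -- For fixed x the equation is quadratic in y, and the second condition is the formula for the sum
  -- of its roots.
  Vertical : (P Q : Carrier × Carrier) → Set ℓ₁
  Vertical (x₁ , y₁) (x₂ , y₂) = x₁ ≈ x₂ × y₁ + y₂ + a₁ * x₁ + a₃ ≈ 0#

  -- Intersections are taken with multiplicity. The point at infinity lies on every vertical line
  -- and meets the line at infinity three times. One constructor for each of its positions makes
  -- cyclic symmetry a matter of matching.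
  data Collinear : Point → Point → Point → Set (c ⊔ ℓ₁) where
    chord     : ∀ {P Q R} → Chord (proj₁ P) (proj₁ Q) (proj₁ R) →
                Collinear (just P) (just Q) (just R)
    vertical₁ : ∀ {P Q} → Vertical (proj₁ P) (proj₁ Q) → Collinear nothing (just P) (just Q)
    vertical₂ : ∀ {P Q} → Vertical (proj₁ P) (proj₁ Q) → Collinear (just Q) nothing (just P)
    vertical₃ : ∀ {P Q} → Vertical (proj₁ P) (proj₁ Q) → Collinear (just P) (just Q) nothing
    infinite  : Collinear nothing nothing nothing

  rotate : ∀ {P Q R} → Collinear P Q R → Collinear Q R P
  rotate (chord (mkChord m b p q r e₁ e₂ e₃)) = chord (mkChord m b q r p
    (trans (solve 3 (λ x y z → y :+ z :+ x := x :+ y :+ z) refl _ _ _) e₁)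
    (trans (solve 3 (λ x y z → y :* z :+ z :* x :+ x :* y := x :* y :+ y :* z :+ z :* x)
      refl _ _ _) e₂)
    (trans (solve 3 (λ x y z → y :* z :* x := x :* y :* z) refl _ _ _) e₃))
  rotate (vertical₁ v) = vertical₃ v
  rotate (vertical₂ v) = vertical₁ v
  rotate (vertical₃ v) = vertical₂ v
  rotate infinite      = infinite

  private
    vertical-sym : ∀ {P Q} → Vertical P Q → Vertical Q P
    vertical-sym {x₁ , y₁} {x₂ , y₂} (x₁≈x₂ , e) = sym x₁≈x₂ , combine
      (solve 6 (λ a₁ a₃ x₁ y₁ x₂ y₂ →
        y₂ :+ y₁ :+ a₁ :* x₂ :+ a₃ :- :0
          := :1 :* (y₁ :+ y₂ :+ a₁ :* x₁ :+ a₃ :- :0) :+ (:- a₁) :* (x₁ :- x₂))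
        refl a₁ a₃ x₁ y₁ x₂ y₂)
      (1# ⊛ e ⊕ (- a₁) ⊛ x₁≈x₂)

    vertical-unique : ∀ {P P′ Q Q′ : AffinePoint} → just P ≈ᴾ just P′ →
      Vertical (proj₁ P) (proj₁ Q) → Vertical (proj₁ P′) (proj₁ Q′) → just Q ≈ᴾ just Q′
    vertical-unique {(x₁ , y₁) , _} {(x₁′ , y₁′) , _} {(x₂ , y₂) , _} {(x₂′ , y₂′) , _}
      (just (p , p′)) (x₁≈x₂ , e) (x₁′≈x₂′ , e′) =
      just (trans (sym x₁≈x₂) (trans p x₁′≈x₂′) , combine
        (solve 8 (λ a₁ a₃ x y x′ y′ z z′ →
          z :- z′
            := :1 :* (y :+ z :+ a₁ :* x :+ a₃ :- :0) :+ (:- :1) :* (y′ :+ z′ :+ a₁ :* x′ :+ a₃ :- :0)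
               :+ (:- :1) :* (y :- y′) :+ (:- a₁) :* (x :- x′))
          refl a₁ a₃ x₁ y₁ x₁′ y₁′ y₂ y₂′)
        (1# ⊛ e ⊕ (- 1#) ⊛ e′ ⊕ (- 1#) ⊛ p′ ⊕ (- a₁) ⊛ p))

    opposite : ∀ (P : AffinePoint) → Σ[ Q ∈ AffinePoint ] Vertical (proj₁ P) (proj₁ Q)
    opposite ((x , y) , on) = ((x , - y - a₁ * x - a₃) , combine
        (solve 7 (λ a₁ a₂ a₃ a₄ a₆ x y →
          :lhs a₁ a₃ x (:- y :- a₁ :* x :- a₃) :- :rhs a₂ a₄ a₆ x
            := :1 :* (:lhs a₁ a₃ x y :- :rhs a₂ a₄ a₆ x))
          refl a₁ a₂ a₃ a₄ a₆ x y)
        (1# ⊛ on))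
      , refl , solve 4 (λ a₁ a₃ x y → y :+ (:- y :- a₁ :* x :- a₃) :+ a₁ :* x :+ a₃ := :0)
          refl a₁ a₃ x y

    -- The x³ and x² coefficients agree by the choice of the third root and
    -- the root x₁ is given, so only the coefficient of x has to be checked.
    chord-through : ∀ {x₁ y₁ x₂ y₂} m (on : OnCurve W (x₁ , y₁)) (on′ : OnCurve W (x₂ , y₂)) →
      let x₃ = m ^ 2 + a₁ * m - a₂ - x₁ - x₂
          b  = y₁ - m * x₁ in
      y₁ - y₂ ≈ m * (x₁ - x₂) →
      x₁ * x₂ + x₂ * x₃ + x₃ * x₁ ≈ a₄ - 2 · (m * b) - a₁ * b - a₃ * m →
      ∃[ R ] Collinear (just ((x₁ , y₁) , on)) (just ((x₂ , y₂) , on′)) (just R)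
    chord-through {x₁} {y₁} {x₂} {y₂} m on on′ slope e₂ =
      ((x₃ , m * x₃ + b) , on″) , chord (mkChord m b
        (solve 3 (λ x y m → y := m :* x :+ (y :- m :* x)) refl x₁ y₁ m)
        (combine
          (solve 5 (λ x₁ y₁ x₂ y₂ m →
            y₂ :- (m :* x₂ :+ (y₁ :- m :* x₁)) := (:- :1) :* (y₁ :- y₂ :- m :* (x₁ :- x₂)))
            refl x₁ y₁ x₂ y₂ m)
          (- 1# ⊛ slope))
        refl
        (solve 3 (λ x₁ x₂ e → x₁ :+ x₂ :+ (e :- x₁ :- x₂) := e) refl x₁ x₂ (m ^ 2 + a₁ * m - a₂))
        e₂
        e₃)
      where
      x₃ = m ^ 2 + a₁ * m - a₂ - x₁ - x₂
      b  = y₁ - m * x₁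

      e₃ : x₁ * x₂ * x₃ ≈ b ^ 2 + a₃ * b - a₆
      e₃ = combine
        (solve 9 (λ a₁ a₂ a₃ a₄ a₆ x₁ y₁ x₂ m →
          let x₃ = m :^ 2 :+ a₁ :* m :- a₂ :- x₁ :- x₂
              b  = y₁ :- m :* x₁ in
          x₁ :* x₂ :* x₃ :- (b :^ 2 :+ a₃ :* b :- a₆)
            := x₁ :* (x₁ :* x₂ :+ x₂ :* x₃ :+ x₃ :* x₁
                      :- (a₄ :- 2 :· (m :* b) :- a₁ :* b :- a₃ :* m))
               :+ (:- :1) :* (:lhs a₁ a₃ x₁ y₁ :- :rhs a₂ a₄ a₆ x₁))
          refl a₁ a₂ a₃ a₄ a₆ x₁ y₁ x₂ m)
        (x₁ ⊛ e₂ ⊕ (- 1#) ⊛ on)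

      on″ : OnCurve W (x₃ , m * x₃ + b)
      on″ = combine
        (solve 9 (λ a₁ a₂ a₃ a₄ a₆ x₁ b x₂ m →
          let x₃ = m :^ 2 :+ a₁ :* m :- a₂ :- x₁ :- x₂ in
          :lhs a₁ a₃ x₃ (m :* x₃ :+ b) :- :rhs a₂ a₄ a₆ x₃
            := x₃ :* (x₁ :* x₂ :+ x₂ :* x₃ :+ x₃ :* x₁
                      :- (a₄ :- 2 :· (m :* b) :- a₁ :* b :- a₃ :* m))
               :+ (:- :1) :* (x₁ :* x₂ :* x₃ :- (b :^ 2 :+ a₃ :* b :- a₆)))
          refl a₁ a₂ a₃ a₄ a₆ x₁ b x₂ m)
        (x₃ ⊛ e₂ ⊕ (- 1#) ⊛ e₃)

    secant : ∀ {x₁ y₁ x₂ y₂} (on : OnCurve W (x₁ , y₁)) (on′ : OnCurve W (x₂ , y₂)) →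
      ¬ x₁ ≈ x₂ → ∃[ R ] Collinear (just ((x₁ , y₁) , on)) (just ((x₂ , y₂) , on′)) (just R)
    secant {x₁} {y₁} {x₂} {y₂} on on′ x₁≉x₂ = chord-through m on on′ slope
      -- Subtracting the two curve equations and using that both points lie on the line leaves
      -- `x₁ - x₂` times the relation sought.
      (*-cancelˡ (x₁≉x₂ ∘ x-y≈0⇒x≈y x₁ x₂) (combine
        (solve 10 (λ a₁ a₂ a₃ a₄ a₆ x₁ y₁ x₂ y₂ m →
          let x₃ = m :^ 2 :+ a₁ :* m :- a₂ :- x₁ :- x₂
              b  = y₁ :- m :* x₁ in
          (x₁ :- x₂) :* (x₁ :* x₂ :+ x₂ :* x₃ :+ x₃ :* x₁)
            :- (x₁ :- x₂) :* (a₄ :- 2 :· (m :* b) :- a₁ :* b :- a₃ :* m)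
            := :1 :* (:lhs a₁ a₃ x₁ y₁ :- :rhs a₂ a₄ a₆ x₁)
               :+ (:- :1) :* (:lhs a₁ a₃ x₂ y₂ :- :rhs a₂ a₄ a₆ x₂)
               :+ (:- (y₂ :+ m :* x₂ :+ b :+ a₁ :* x₂ :+ a₃))
                 :* (y₁ :- y₂ :- m :* (x₁ :- x₂)))
          refl a₁ a₂ a₃ a₄ a₆ x₁ y₁ x₂ y₂ m)
        (1# ⊛ on ⊕ (- 1#) ⊛ on′ ⊕ (- (y₂ + m * x₂ + (y₁ - m * x₁) + a₁ * x₂ + a₃)) ⊛ slope)))
      where
      inv = inverse (x₁≉x₂ ∘ x-y≈0⇒x≈y x₁ x₂)
      m = proj₁ inv * (y₁ - y₂)

      slope : y₁ - y₂ ≈ m * (x₁ - x₂)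
      slope = combine
        (solve 3 (λ dx dy z → dy :- z :* dy :* dx := (:- dy) :* (z :* dx :- :1))
          refl (x₁ - x₂) (y₁ - y₂) (proj₁ inv))
        (- (y₁ - y₂) ⊛ proj₂ inv)

    -- Two points over the same x that are not opposite coincide. The nonzero quantity in the
    -- hypothesis then agrees with `∂y x₁ y₁`, so its inverse gives the tangent slope.
    tangent : ∀ {x₁ y₁ x₂ y₂} (on : OnCurve W (x₁ , y₁)) (on′ : OnCurve W (x₂ , y₂)) →
      x₁ ≈ x₂ → ¬ y₁ + y₂ + a₁ * x₁ + a₃ ≈ 0# →
      ∃[ R ] Collinear (just ((x₁ , y₁) , on)) (just ((x₂ , y₂) , on′)) (just R)
    tangent {x₁} {y₁} {x₂} {y₂} on on′ x₁≈x₂ ∂≉0 = chord-through m on on′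
      (combine
        (solve 5 (λ x₁ y₁ x₂ y₂ m →
          y₁ :- y₂ :- m :* (x₁ :- x₂) := :1 :* (y₁ :- y₂) :+ (:- m) :* (x₁ :- x₂))
          refl x₁ y₁ x₂ y₂ m)
        (1# ⊛ y₁≈y₂ ⊕ (- m) ⊛ x₁≈x₂))
      (combine
        (solve 9 (λ a₁ a₂ a₃ a₄ x₁ y₁ x₂ y₂ z →
          let m  = z :* :∂x a₁ a₂ a₄ x₁ y₁
              x₃ = m :^ 2 :+ a₁ :* m :- a₂ :- x₁ :- x₂
              b  = y₁ :- m :* x₁ in
          x₁ :* x₂ :+ x₂ :* x₃ :+ x₃ :* x₁ :- (a₄ :- 2 :· (m :* b) :- a₁ :* b :- a₃ :* m)
            := :∂x a₁ a₂ a₄ x₁ y₁ :* (z :* (y₁ :+ y₂ :+ a₁ :* x₁ :+ a₃) :- :1)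
               :+ m :* (y₁ :- y₂)
               :+ (2 :· x₁ :+ x₂ :- (m :^ 2 :+ a₁ :* m :- a₂)) :* (x₁ :- x₂))
          refl a₁ a₂ a₃ a₄ x₁ y₁ x₂ y₂ (proj₁ inv))
        (∂x x₁ y₁ ⊛ proj₂ inv ⊕ m ⊛ y₁≈y₂ ⊕ (2 · x₁ + x₂ - (m ^ 2 + a₁ * m - a₂)) ⊛ x₁≈x₂))
      where
      inv = inverse ∂≉0
      m = proj₁ inv * ∂x x₁ y₁

      -- For equal x the difference of the curve equations factors into `y₁ - y₂` and the quantity
      -- assumed nonzero.
      y₁≈y₂ : y₁ ≈ y₂
      y₁≈y₂ = x-y≈0⇒x≈y y₁ y₂ (x*y≈0⇒y≈0 ∂≉0 (combine
        (solve 9 (λ a₁ a₂ a₃ a₄ a₆ x₁ y₁ x₂ y₂ →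
          (y₁ :+ y₂ :+ a₁ :* x₁ :+ a₃) :* (y₁ :- y₂) :- :0
            := :1 :* (:lhs a₁ a₃ x₁ y₁ :- :rhs a₂ a₄ a₆ x₁)
               :+ (:- :1) :* (:lhs a₁ a₃ x₂ y₂ :- :rhs a₂ a₄ a₆ x₂)
               :+ (x₁ :^ 2 :+ x₁ :* x₂ :+ x₂ :^ 2 :+ a₂ :* (x₁ :+ x₂) :+ a₄ :- a₁ :* y₂)
                 :* (x₁ :- x₂))
          refl a₁ a₂ a₃ a₄ a₆ x₁ y₁ x₂ y₂)
        (1# ⊛ on ⊕ (- 1#) ⊛ on′
          ⊕ (x₁ ^ 2 + x₁ * x₂ + x₂ ^ 2 + a₂ * (x₁ + x₂) + a₄ - a₁ * y₂) ⊛ x₁≈x₂)))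

  third : ∀ P Q → ∃[ R ] Collinear P Q R
  third nothing  nothing  = nothing , infinite
  third nothing  (just P) = let Q , v = opposite P in just Q , vertical₁ v
  third (just P) nothing  = let Q , v = opposite P in just Q , vertical₂ (vertical-sym v)
  third (just ((x₁ , y₁) , on)) (just ((x₂ , y₂) , on′)) with x₁ ≟ x₂
  ... | no x₁≉x₂  = let R , col = secant on on′ x₁≉x₂ in just R , col
  ... | yes x₁≈x₂ with y₁ + y₂ + a₁ * x₁ + a₃ ≟ 0#
  ...   | yes ∂≈0 = nothing , vertical₃ (x₁≈x₂ , ∂≈0)
  ...   | no  ∂≉0 = let R , col = tangent on on′ x₁≈x₂ ∂≉0 in just R , col

  -- At a double root the derivative of the restricted cubic vanishes. Stating the slope without
  -- division allows the use below where `∂y` is supposed to vanish.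
  chord-tangent : ∀ {x₁ y₁ x₂ y₂ R} → (C : Chord (x₁ , y₁) (x₂ , y₂) R) → x₁ ≈ x₂ →
    Chord.m C * ∂y x₁ y₁ ≈ ∂x x₁ y₁
  chord-tangent {x₁} {y₁} {x₂} {y₂} {x₃ , y₃} (mkChord m b p q r e₁ e₂ e₃) x₁≈x₂ = combine
    (solve 10 (λ a₁ a₂ a₃ a₄ x₁ y₁ x₂ x₃ m b →
      m :* :∂y a₁ a₃ x₁ y₁ :- :∂x a₁ a₂ a₄ x₁ y₁
        := :1 :* (x₁ :* x₂ :+ x₂ :* x₃ :+ x₃ :* x₁
                  :- (a₄ :- 2 :· (m :* b) :- a₁ :* b :- a₃ :* m))
           :+ (:- (2 :· x₁ :+ x₂ :- (m :^ 2 :+ a₁ :* m :- a₂))) :* (x₁ :- x₂)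
           :+ (:- (x₁ :+ x₂)) :* (x₁ :+ x₂ :+ x₃ :- (m :^ 2 :+ a₁ :* m :- a₂))
           :+ (2 :· m :+ a₁) :* (y₁ :- (m :* x₁ :+ b)))
      refl a₁ a₂ a₃ a₄ x₁ y₁ x₂ x₃ m b)
    (1# ⊛ e₂ ⊕ (- (2 · x₁ + x₂ - (m ^ 2 + a₁ * m - a₂))) ⊛ x₁≈x₂ ⊕ (- (x₁ + x₂)) ⊛ e₁
      ⊕ (2 · m + a₁) ⊛ p)

  module Nonsingular (Δ≉0 : ¬ discriminant W ≈ 0#) where

    -- If `∂y` vanished, `chord-tangent` would make `∂x` vanish too, and the point would be
    -- singular.
    chord⇒∂y≉0 : ∀ {x₁ y₁ x₂ y₂ R} → OnCurve W (x₁ , y₁) → Chord (x₁ , y₁) (x₂ , y₂) R →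
      x₁ ≈ x₂ → ¬ ∂y x₁ y₁ ≈ 0#
    chord⇒∂y≉0 on C x₁≈x₂ ∂y≈0 = Δ≉0 (singular⇒discriminant≈0 on
      (trans (sym (chord-tangent C x₁≈x₂)) (trans (*-congˡ ∂y≈0) (zeroʳ _))) ∂y≈0)

    private
      chord-y : ∀ {x₁ y₁ x₂ y₂ R} → Chord (x₁ , y₁) (x₂ , y₂) R → x₁ ≈ x₂ → y₁ ≈ y₂
      chord-y (mkChord m b p q r e₁ e₂ e₃) x₁≈x₂ =
        trans p (trans (+-congʳ (*-congˡ x₁≈x₂)) (sym q))

      chord⇒¬vertical : ∀ {P Q R} → OnCurve W P → Chord P Q R → ¬ Vertical P Q
      chord⇒¬vertical {x₁ , y₁} {x₂ , y₂} on C (x₁≈x₂ , ∂≈0) = chord⇒∂y≉0 on C x₁≈x₂ (combine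
        (solve 5 (λ a₁ a₃ x₁ y₁ y₂ →
          :∂y a₁ a₃ x₁ y₁ :- :0
            := :1 :* (y₁ :+ y₂ :+ a₁ :* x₁ :+ a₃ :- :0) :+ :1 :* (y₁ :- y₂))
          refl a₁ a₃ x₁ y₁ y₂)
        (1# ⊛ ∂≈0 ⊕ 1# ⊛ chord-y C x₁≈x₂))

      -- Distinct x determine the slope by the two points; equal x determine it by tangency, after
      -- cancelling the nonzero `∂y`.
      chord-slope : ∀ {x₁ y₁ x₂ y₂ R R′} → OnCurve W (x₁ , y₁) →
        (C : Chord (x₁ , y₁) (x₂ , y₂) R) (C′ : Chord (x₁ , y₁) (x₂ , y₂) R′) →
        Chord.m C ≈ Chord.m C′
      chord-slope {x₁} {y₁} {x₂} {y₂} on C@(mkChord m b p q _ _ _ _) C′@(mkChord m′ b′ p′ q′ _ _ _ _)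
        with x₁ ≟ x₂
      ... | yes x₁≈x₂ = *-cancelˡ (chord⇒∂y≉0 on C x₁≈x₂)
        (trans (*-comm _ _) (trans (chord-tangent C x₁≈x₂)
          (trans (sym (chord-tangent C′ x₁≈x₂)) (*-comm _ _))))
      ... | no  x₁≉x₂ = *-cancelˡ (x₁≉x₂ ∘ x-y≈0⇒x≈y x₁ x₂) (combine
        (solve 8 (λ x₁ y₁ x₂ y₂ m b m′ b′ →
          (x₁ :- x₂) :* m :- (x₁ :- x₂) :* m′
            := (:- :1) :* (y₁ :- (m :* x₁ :+ b)) :+ :1 :* (y₁ :- (m′ :* x₁ :+ b′))
               :+ :1 :* (y₂ :- (m :* x₂ :+ b)) :+ (:- :1) :* (y₂ :- (m′ :* x₂ :+ b′)))
          refl x₁ y₁ x₂ y₂ m b m′ b′)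
        (- 1# ⊛ p ⊕ 1# ⊛ p′ ⊕ 1# ⊛ q ⊕ (- 1#) ⊛ q′))

      chord-unique : ∀ {P Q x₃ y₃ x₃′ y₃′} → OnCurve W P →
        Chord P Q (x₃ , y₃) → Chord P Q (x₃′ , y₃′) → x₃ ≈ x₃′ × y₃ ≈ y₃′
      chord-unique {x₁ , y₁} {x₂ , y₂} {x₃} {y₃} {x₃′} {y₃′} on
        C@(mkChord m b p _ r e₁ _ _) C′@(mkChord m′ b′ p′ _ r′ e₁′ _ _) = x₃≈ , combine
        (solve 8 (λ x₃ y₃ x₃′ y₃′ m b m′ b′ →
          y₃ :- y₃′
            := :1 :* (y₃ :- (m :* x₃ :+ b)) :+ (:- :1) :* (y₃′ :- (m′ :* x₃′ :+ b′))
               :+ m :* (x₃ :- x₃′) :+ x₃′ :* (m :- m′) :+ :1 :* (b :- b′))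
          refl x₃ y₃ x₃′ y₃′ m b m′ b′)
        (1# ⊛ r ⊕ (- 1#) ⊛ r′ ⊕ m ⊛ x₃≈ ⊕ x₃′ ⊛ m≈ ⊕ 1# ⊛ b≈)
        where
        m≈ : m ≈ m′
        m≈ = chord-slope on C C′

        b≈ : b ≈ b′
        b≈ = combine
          (solve 6 (λ x₁ y₁ m b m′ b′ →
            b :- b′
              := (:- :1) :* (y₁ :- (m :* x₁ :+ b)) :+ :1 :* (y₁ :- (m′ :* x₁ :+ b′))
                 :+ (:- x₁) :* (m :- m′))
            refl x₁ y₁ m b m′ b′)
          (- 1# ⊛ p ⊕ 1# ⊛ p′ ⊕ (- x₁) ⊛ m≈)

        x₃≈ : x₃ ≈ x₃′
        x₃≈ = combine
          (solve 8 (λ a₁ a₂ x₁ x₂ x₃ x₃′ m m′ →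
            x₃ :- x₃′
              := :1 :* (x₁ :+ x₂ :+ x₃ :- (m :^ 2 :+ a₁ :* m :- a₂))
                 :+ (:- :1) :* (x₁ :+ x₂ :+ x₃′ :- (m′ :^ 2 :+ a₁ :* m′ :- a₂))
                 :+ (m :+ m′ :+ a₁) :* (m :- m′))
            refl a₁ a₂ x₁ x₂ x₃ x₃′ m m′)
          (1# ⊛ e₁ ⊕ (- 1#) ⊛ e₁′ ⊕ (m + m′ + a₁) ⊛ m≈)

      vertical-resp : ∀ {x₁ y₁ x₂ y₂ x₁′ y₁′ x₂′ y₂′} → x₁ ≈ x₁′ → y₁ ≈ y₁′ → x₂ ≈ x₂′ → y₂ ≈ y₂′ →
        Vertical (x₁ , y₁) (x₂ , y₂) → Vertical (x₁′ , y₁′) (x₂′ , y₂′)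
      vertical-resp p p′ q q′ (x₁≈x₂ , e) = trans (sym p) (trans x₁≈x₂ q)
        , trans (sym (+-congʳ (+-cong (+-cong p′ q′) (*-congˡ p)))) e

    chord-resp : ∀ {x₁ y₁ x₂ y₂ x₁′ y₁′ x₂′ y₂′ R} → x₁ ≈ x₁′ → y₁ ≈ y₁′ → x₂ ≈ x₂′ → y₂ ≈ y₂′ →
      Chord (x₁ , y₁) (x₂ , y₂) R → Chord (x₁′ , y₁′) (x₂′ , y₂′) R
    chord-resp p p′ q q′ (mkChord m b P∈ Q∈ R∈ e₁ e₂ e₃) = mkChord m b
      (trans (sym p′) (trans P∈ (+-congʳ (*-congˡ p))))
      (trans (sym q′) (trans Q∈ (+-congʳ (*-congˡ q))))
      R∈
      (trans (sym (+-congʳ (+-cong p q))) e₁)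
      (trans (sym (+-cong (+-cong (*-cong p q) (*-congʳ q)) (*-congˡ p))) e₂)
      (trans (sym (*-congʳ (*-cong p q))) e₃)

    -- This makes the third intersection an operation respecting equality. Nonsingularity excludes
    -- that a chord and a vertical line pass through the same pair, and it fixes the slope at a
    -- double point.
    third-unique : ∀ {P Q R P′ Q′ R′} → P ≈ᴾ P′ → Q ≈ᴾ Q′ →
      Collinear P Q R → Collinear P′ Q′ R′ → R ≈ᴾ R′
    third-unique _ _ infinite infinite = nothing
    third-unique _ q (vertical₁ v) (vertical₁ v′) = vertical-unique q v v′
    third-unique p _ (vertical₂ v) (vertical₂ v′) = vertical-unique p (vertical-sym v) (vertical-sym v′)
    third-unique _ _ (vertical₃ v) (vertical₃ v′) = nothing
    third-unique (just (p , p′)) (just (q , q′)) (chord {P′} C) (vertical₃ v) =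
      contradiction (vertical-resp (sym p) (sym p′) (sym q) (sym q′) v) (chord⇒¬vertical (proj₂ P′) C)
    third-unique (just (p , p′)) (just (q , q′)) (vertical₃ v) (chord {P′} C) =
      contradiction (vertical-resp p p′ q q′ v) (chord⇒¬vertical (proj₂ P′) C)
    third-unique (just (p , p′)) (just (q , q′)) (chord C) (chord {P′} C′) =
      just (chord-unique (proj₂ P′) (chord-resp p p′ q q′ C) C′)

    module _ {n} (cardᴾ : HasCardinality (points W) n) where
      private
        module Pair = Setoid (×-setoid (points W) (points W))
        open Finite cardᴾ using () renaming (_≟_ to infix 4 _≟ᴾ_; any? to any?ᴾ)

        infixl 7 _∙_
        _∙_ : Point → Point → Point
        P ∙ Q = proj₁ (third P Q)

        ∙-unique : ∀ {P Q R} → Collinear P Q R → P ∙ Q ≈ᴾ R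
        ∙-unique {P} {Q} = third-unique Points.refl Points.refl (proj₂ (third P Q))

        ∙-cong : ∀ {P Q P′ Q′} → P ≈ᴾ P′ → Q ≈ᴾ Q′ → P ∙ Q ≈ᴾ P′ ∙ Q′
        ∙-cong {P} {Q} {P′} {Q′} p q = third-unique p q (proj₂ (third P Q)) (proj₂ (third P′ Q′))

        -- By uniqueness, a rotated collinear triple computes the operation on its next pair; this
        -- gives `σ` its period three.
        ∙-rotate : ∀ P Q → Q ∙ (P ∙ Q) ≈ᴾ P
        ∙-rotate P Q = ∙-unique (rotate (proj₂ (third P Q)))

        ∙-rotate² : ∀ P Q → (P ∙ Q) ∙ P ≈ᴾ Q
        ∙-rotate² P Q = ∙-unique (rotate (rotate (proj₂ (third P Q))))

        σ : Point × Point → Point × Point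
        σ (P , Q) = Q , P ∙ Q

        module Pairs = Finite.OrderThree (×-hasCardinality cardᴾ cardᴾ) σ
          (λ (p , q) → q , ∙-cong p q)
          (λ (P , Q) → ∙-rotate P Q , Points.trans (∙-cong {P ∙ Q} Points.refl (∙-rotate P Q)) (∙-rotate² P Q))

        flex⇒chord : ∀ {P} → just P ∙ just P ≈ᴾ just P → Chord (proj₁ P) (proj₁ P) (proj₁ P)
        flex⇒chord {P} = lemma (third (just P) (just P))
          where
          lemma : ∀ (R : ∃[ R ] Collinear (just P) (just P) R) → proj₁ R ≈ᴾ just P →
            Chord (proj₁ P) (proj₁ P) (proj₁ P)
          -- `chord-resp` changes only the first two points, so the triple is first rotated to `P`,
          -- `R`, `P`.
          lemma (just R , chord C) (just (r , r′)) with rotate (chord {P} {P} {R} C)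
          ... | chord C′ = chord-resp refl refl r r′ C′

      -- If the search finds no affine flex, the pair of points at infinity is the only fixed point
      -- of `σ`. Then `n * n` is 1 mod 3, contradicting that 3 divides `n`.
      3∣#⇒flex : 3 ∣ n → ∃[ P ] OnCurve W P × Chord P P P
      3∣#⇒flex 3∣n with any?ᴾ {P = λ P → ¬ P ≈ᴾ nothing × P ∙ P ≈ᴾ P}
        (λ P≈Q (P≉O , e) → P≉O ∘ Points.trans P≈Q
          , Points.trans (∙-cong (Points.sym P≈Q) (Points.sym P≈Q)) (Points.trans e P≈Q))
        (λ P → ¬? (P ≟ᴾ nothing) ×-dec P ∙ P ≟ᴾ P)
      ... | yes (nothing , O≉O , _)     = contradiction nothing O≉O
      ... | yes (just (P , on) , _ , e) = P , on , flex⇒chord e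
      ... | no ¬flex = contradiction (∣n⇒∣m*n n 3∣n)
        (¬3∣ (Pairs.one-fixed (nothing , nothing) (nothing , nothing) unique))
        where
        unique : ∀ PQ → σ PQ Pair.≈ PQ → PQ Pair.≈ (nothing , nothing)
        unique (P , Q) (Q≈P , R≈Q) with P ≟ᴾ nothing
        ... | yes P≈O = P≈O , Points.trans Q≈P P≈O
        ... | no  P≉O = contradiction (P , P≉O , Points.trans
          (∙-cong {P} Points.refl (Points.sym Q≈P)) (Points.trans R≈Q Q≈P)) ¬flex

        ¬3∣ : ∃[ m ] n ℕ.* n ≡ m ℕ.* 3 ℕ.+ 1 → ¬ 3 ∣ n ℕ.* n
        ¬3∣ (m , e) d = from-no (3 ∣? 1) (∣m+n∣m⇒∣n (≡.subst (3 ∣_) e d) (n∣m*n m))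

-- Finiteness of the set of rational points.

module PointCount {c ℓ₁ ℓ₂} (F : HeytingField c ℓ₁ ℓ₂) {q}
  (card : HasCardinality (EllipticCurves.setoid F) q)
  (W : WeierstrassCurve (HeytingField.Carrier F)) where
  open FiniteField F card
  open WeierstrassCurve W

  OnCurve-resp : ∀ {x y x′ y′} → x ≈ x′ → y ≈ y′ → OnCurve W (x , y) → OnCurve W (x′ , y′)
  OnCurve-resp p q on = trans
    (sym (+-cong (+-cong (^-congˡ 2 q) (*-cong (*-congˡ p) q)) (*-congˡ q)))
    (trans on (+-congʳ (+-cong (+-cong (^-congˡ 3 p) (*-congˡ (^-congˡ 2 p))) (*-congˡ p))))

  points-finite : ∃[ n ] HasCardinality (points W) n
  points-finite = enumerated⇒finite S (nothing ∷ tabulate (point ∘ Bijection.to card²)) complete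
    where
    card² = ×-hasCardinality card card

    S : DecSetoid _ _
    S = record
      { isDecEquivalence = record
        { isEquivalence = Setoid.isEquivalence (points W)
        ; _≟_           = Maybe.dec λ (P , _) (Q , _) → ×-decidable _≟_ _≟_ P Q
        }
      }

    open DecSetoid S using () renaming (Carrier to Point; _≈_ to _≈ᴾ_)

    point : Carrier × Carrier → Point
    point P@(x , y)
      with y ^ 2 + a₁ * x * y + a₃ * y ≟ x ^ 3 + a₂ * x ^ 2 + a₄ * x + a₆
    ... | yes on = just (P , on)
    -- Pairs off the curve default to the point at infinity; the repetitions are removed by
    -- `enumerated⇒finite`.
    ... | no  _  = nothing

    point-resp : ∀ {P Q} (on : OnCurve W P) → proj₁ P ≈ proj₁ Q → proj₂ P ≈ proj₂ Q →
      just (P , on) ≈ᴾ point Q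
    point-resp {Q = x , y} on p q
      with y ^ 2 + a₁ * x * y + a₃ * y ≟ x ^ 3 + a₂ * x ^ 2 + a₄ * x + a₆
    ... | yes _   = just (p , q)
    ... | no  ¬on = contradiction (OnCurve-resp p q on) ¬on

    complete : ∀ P → _
    complete nothing         = here nothing
    complete (just (P , on)) =
      let p , q = Finite.to-from card² P
      in there (tabulate⁺ (Finite.from card² P) (point-resp on (sym p) (sym q)))

-- The family y² + a x y + y = x³: normal form, three-torsion, injectivity.

module Family {c ℓ₁ ℓ₂} (F : HeytingField c ℓ₁ ℓ₂) {q}
  (card : HasCardinality (EllipticCurves.setoid F) q) (3∣q+1 : 3 ∣ q ℕ.+ 1) where
  open Field≡2mod3 F card 3∣q+1
  open Discriminant F

  discriminant-family≉0 : ∀ {a} → ¬ a ≈ 3 · 1# → ¬ discriminant (family a) ≈ 0#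
  discriminant-family≉0 {a} a≉3 Δ≈0 = a≉3 (³-injective (combine
    (solve 1 (λ a → a :^ 3 :- (3 :· :1) :^ 3 := :1 :* (:1 :^ 3 :* (a :^ 3 :- 27 :· :1) :- :0)) refl a)
    (1# ⊛ trans (sym (discriminant-flex-at-0 a 1#)) Δ≈0)))

  module _ (W : WeierstrassCurve Carrier) (Δ≉0 : ¬ discriminant W ≈ 0#) where
    open WeierstrassCurve W
    open ChordTangent F card W

    flex⇒≅family : ∀ {P} → OnCurve W P → Chord P P P → ∃[ a ] (¬ a ≈ 3 · 1# × family a ≅ W)
    flex⇒≅family {x , y} on (mkChord m b p _ _ e₁ e₂ _) = v * A , a≉3 , ≅.sym {W} {family (v * A)}
      (u , x , m , y , ≉⇒# u≉0 , ≈ᵂ.trans {scale u (family (v * A))} {weierstrass A 0# B 0# 0#}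
        (mk≈ᵂ uvA≈A (zeroʳ _) (trans (*-identityʳ _) u³≈B) (zeroʳ _) (zeroʳ _))
        (≈ᵂ.sym {translate x m y W} translate≈))
      where
      module ≅  = Setoid isoSetoid
      module ≈ᵂ = Setoid ≈ᵂ-setoid
      A B : Carrier
      A = a₁ + 2 · m
      B = a₃ + x * a₁ + 2 · y

      -- Since `x` is a triple root along the tangent, `e₁` and `e₂` remove `a₂` and `a₄`; the curve
      -- equation removes `a₆`.
      translate≈ : translate x m y W ≈ᵂ weierstrass A 0# B 0# 0#
      translate≈ = mk≈ᵂ refl
        (combine
          (solve 4 (λ a₁ a₂ x m →
            a₂ :- m :* a₁ :+ 3 :· x :- m :^ 2 :- :0
              := :1 :* (x :+ x :+ x :- (m :^ 2 :+ a₁ :* m :- a₂)))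
            refl a₁ a₂ x m)
          (1# ⊛ e₁))
        refl
        (combine
          (solve 8 (λ a₁ a₂ a₃ a₄ x y m b →
            a₄ :- m :* a₃ :+ 2 :· (x :* a₂) :- (y :+ x :* m) :* a₁ :+ 3 :· (x :^ 2)
               :- 2 :· (m :* y) :- :0
              := (:- :1) :* (x :* x :+ x :* x :+ x :* x
                             :- (a₄ :- 2 :· (m :* b) :- a₁ :* b :- a₃ :* m))
                 :+ 2 :· x :* (x :+ x :+ x :- (m :^ 2 :+ a₁ :* m :- a₂))
                 :+ (:- (a₁ :+ 2 :· m)) :* (y :- (m :* x :+ b)))
            refl a₁ a₂ a₃ a₄ x y m b)
          (- 1# ⊛ e₂ ⊕ 2 · x ⊛ e₁ ⊕ (- (a₁ + 2 · m)) ⊛ p))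
        (combine
          (solve 7 (λ a₁ a₂ a₃ a₄ a₆ x y →
            a₆ :+ x :* a₄ :+ x :^ 2 :* a₂ :+ x :^ 3 :- y :* a₃ :- y :^ 2 :- x :* y :* a₁ :- :0
              := (:- :1) :* (y :^ 2 :+ a₁ :* x :* y :+ a₃ :* y
                             :- (x :^ 3 :+ a₂ :* x :^ 2 :+ a₄ :* x :+ a₆)))
            refl a₁ a₂ a₃ a₄ a₆ x y)
          (- 1# ⊛ on))

      B³[A³-27B]≉0 : ¬ B ^ 3 * (A ^ 3 - 27 · B) ≈ 0#
      B³[A³-27B]≉0 e = Δ≉0 (trans (sym (discriminant-translate x m y W))
        (trans (discriminant-cong translate≈) (trans (discriminant-flex-at-0 A B) e)))

      u = proj₁ (³-surjective B)

      u³≈B : u ^ 3 ≈ B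
      u³≈B = proj₂ (³-surjective B)

      u≉0 : ¬ u ≈ 0#
      u≉0 u≈0 = B³[A³-27B]≉0 (trans (*-congʳ (trans (^-congˡ 3 (trans (sym u³≈B)
        (trans (^-congˡ 3 u≈0) (zeroˡ _)))) (zeroˡ _))) (zeroˡ _))

      v = proj₁ (inverse u≉0)

      uvA≈A : u * (v * A) ≈ A
      uvA≈A = combine
        (solve 3 (λ u v A → u :* (v :* A) :- A := A :* (v :* u :- :1)) refl u v A)
        (A ⊛ proj₂ (inverse u≉0))

      -- Here `v * A` is A/u. Were it 3, then A³ = 27 u³ = 27 B would annul the second factor of the
      -- discriminant.
      a≉3 : ¬ v * A ≈ 3 · 1#
      a≉3 a≈3 = B³[A³-27B]≉0 (trans (*-congˡ (combine
        (solve 3 (λ u A B →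
          A :^ 3 :- 27 :· B :- :0
            := (A :^ 2 :+ A :* (u :* 3 :· :1) :+ (u :* 3 :· :1) :^ 2) :* (A :- u :* 3 :· :1)
               :+ 27 :· :1 :* (u :^ 3 :- B))
          refl u A B)
        ((A ^ 2 + A * (u * 3 · 1#) + (u * 3 · 1#) ^ 2)
            ⊛ trans (sym uvA≈A) (*-congˡ a≈3)
          ⊕ 27 · 1# ⊛ u³≈B))) (zeroʳ _))

  -- Translation by the point (0 , 0) of order three, relationally.
  module _ (a : Carrier) where
    private
      module Points = Setoid (points (family a))
      open Points using () renaming (Carrier to Point; _≈_ to _≈ᴾ_)
      open PointCount F card (family a)

      Affine = Σ[ P ∈ Carrier × Carrier ] OnCurve (family a) P

      :lhs : ∀ {n} (a x y : Polynomial n) → Polynomial n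
      :lhs a x y = y :^ 2 :+ a :* x :* y :+ :1 :* y

      :rhs : ∀ {n} (x : Polynomial n) → Polynomial n
      :rhs x = x :^ 3 :+ :0 :* x :^ 2 :+ :0 :* x :+ :0

      -- The translation formulas with denominators cleared, the second one as y′ x = x′.
      record Generic (P Q : Carrier × Carrier) : Set ℓ₁ where
        constructor generic
        private
          x  = proj₁ P
          x′ = proj₁ Q
        field
          x≉0 : ¬ x ≈ 0#
          x′≈ : x′ * x ^ 2 ≈ - proj₂ P
          y′≈ : proj₂ Q * x ≈ x′

      -- The point at infinity, (0 , 0) and (0 , -1) form the orbit of the identity; every other
      -- point has nonzero x and follows the generic formula.
      data Step : Point → Point → Set (c ⊔ ℓ₁) where
        O↦T   : ∀ {x y on} → x ≈ 0# → y ≈ 0# → Step nothing (just ((x , y) , on))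
        T↦-T  : ∀ {x y x′ y′ on on′} → x ≈ 0# → y ≈ 0# → x′ ≈ 0# → y′ ≈ - 1# →
                Step (just ((x , y) , on)) (just ((x′ , y′) , on′))
        -T↦O  : ∀ {x y on} → x ≈ 0# → y ≈ - 1# → Step (just ((x , y) , on)) nothing
        other : ∀ {P Q} → Generic (proj₁ P) (proj₁ Q) → Step (just P) (just Q)

      0≉-1 : ∀ {y} → y ≈ 0# → ¬ y ≈ - 1#
      0≉-1 {y} y≈0 y≈-1 = 1≉0 (combine
        (solve 1 (λ y → :1 :- :0 := :1 :* (y :- :- :1) :+ (:- :1) :* (y :- :0)) refl y)
        (1# ⊛ y≈-1 ⊕ (- 1#) ⊛ y≈0))

      T -T : Affine
      T  = (0# , 0#) , solve 1 (λ a → :lhs a :0 :0 := :rhs :0) refl a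
      -T = (0# , - 1#) , solve 1 (λ a → :lhs a :0 (:- :1) := :rhs :0) refl a

      total : ∀ P → ∃[ Q ] Step P Q
      total nothing = just T , O↦T refl refl
      total (just ((x , y) , on)) with x ≟ 0#
      ... | yes x≈0 with y ≟ 0#
      ...   | yes y≈0 = just -T , T↦-T x≈0 y≈0 refl refl
      -- At x = 0 the curve equation reads y (y + 1) = 0.
      ...   | no  y≉0 = nothing , -T↦O x≈0 (x-y≈0⇒x≈y y (- 1#) (x*y≈0⇒y≈0 y≉0 (combine
        (solve 3 (λ a x y →
          y :* (y :- :- :1) :- :0 := :1 :* (:lhs a x y :- :rhs x) :+ (x :^ 2 :- a :* y) :* (x :- :0))
          refl a x y)
        (1# ⊛ on ⊕ (x ^ 2 - a * y) ⊛ x≈0))))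
      total (just ((x , y) , on)) | no x≉0 = just ((x′ , y′) , on′) , other (generic x≉0
        (combine
          (solve 3 (λ x y z →
            :- (y :* z :^ 2) :* x :^ 2 :- :- y := (:- (y :* (z :* x :+ :1))) :* (z :* x :- :1))
            refl x y z)
          (- (y * (z * x + 1#)) ⊛ zx≈1))
        (combine
          (solve 3 (λ x x′ z → x′ :* z :* x :- x′ := x′ :* (z :* x :- :1)) refl x x′ z)
          (x′ ⊛ zx≈1)))
        where
        z = proj₁ (inverse x≉0)
        zx≈1 = proj₂ (inverse x≉0)
        x′ = - (y * z ^ 2)
        y′ = x′ * z

        on′ : OnCurve (family a) (x′ , y′)
        on′ = combine
          (solve 4 (λ a x y z →
            let x′ = :- (y :* z :^ 2)
                y′ = x′ :* z in
            :lhs a x′ y′ :- :rhs x′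
              := y :* z :^ 6 :* (:lhs a x y :- :rhs x)
                 :+ (y :* z :^ 3 :* (z :^ 2 :* x :^ 2 :+ z :* x :+ :1) :- a :* y :^ 2 :* z :^ 5)
                   :* (z :* x :- :1))
            refl a x y z)
          (y * z ^ 6 ⊛ on
            ⊕ (y * z ^ 3 * (z ^ 2 * x ^ 2 + z * x + 1#) - a * y ^ 2 * z ^ 5) ⊛ zx≈1)

      unique : ∀ {P P′ Q Q′} → P ≈ᴾ P′ → Step P Q → Step P′ Q′ → Q ≈ᴾ Q′
      unique _ (O↦T p q) (O↦T p′ q′) = just (trans p (sym p′) , trans q (sym q′))
      unique _ (T↦-T _ _ p q) (T↦-T _ _ p′ q′) = just (trans p (sym p′) , trans q (sym q′))
      unique (just (_ , e)) (T↦-T _ p _ _) (-T↦O _ q) = contradiction (trans e q) (0≉-1 p)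
      unique (just (e , _)) (T↦-T p _ _ _) (other (generic x≉0 _ _)) = contradiction (trans (sym e) p) x≉0
      unique (just (_ , e)) (-T↦O _ q) (T↦-T _ p _ _) = contradiction q (0≉-1 (trans e p))
      unique _ (-T↦O _ _) (-T↦O _ _) = nothing
      unique (just (e , _)) (-T↦O p _) (other (generic x≉0 _ _)) = contradiction (trans (sym e) p) x≉0
      unique (just (e , _)) (other (generic x≉0 _ _)) (T↦-T p _ _ _) = contradiction (trans e p) x≉0
      unique (just (e , _)) (other (generic x≉0 _ _)) (-T↦O p _) = contradiction (trans e p) x≉0
      unique (just (p , p′)) (other (generic x≉0 e f)) (other (generic _ e′ f′)) = just (x≈ , y≈)
        where
        x≈ = *-cancelˡ (x≉0 ∘ x^n≈0⇒x≈0 2) (trans (*-comm _ _) (trans e (trans (-‿cong p′)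
          (trans (sym e′) (trans (*-congˡ (^-congˡ 2 (sym p))) (*-comm _ _))))))
        y≈ = *-cancelˡ x≉0 (trans (*-comm _ _) (trans f (trans x≈
          (trans (sym f′) (trans (*-congˡ (sym p)) (*-comm _ _))))))

      -- If x′ were 0, then y would be 0, and the curve equation would give x³ = 0. Generic points
      -- therefore never step into the exceptional orbit.
      generic-x′≉0 : ∀ {P Q} → OnCurve (family a) P → Generic P Q → ¬ proj₁ Q ≈ 0#
      generic-x′≉0 {x , y} {x′ , y′} on (generic x≉0 e _) x′≈0 = x≉0 (x^n≈0⇒x≈0 3 (combine
        (solve 4 (λ a x y x′ →
          x :^ 3 :- :0
            := (:- :1) :* (:lhs a x y :- :rhs x)
               :+ (y :+ a :* x :+ :1) :* (x′ :* x :^ 2 :- :- y)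
               :+ (:- ((y :+ a :* x :+ :1) :* x :^ 2)) :* (x′ :- :0))
          refl a x y x′)
        (- 1# ⊛ on ⊕ (y + a * x + 1#) ⊛ e ⊕ (- ((y + a * x + 1#) * x ^ 2)) ⊛ x′≈0)))

      -- The invariant behind period three: comparing it for two overlapping triples identifies the
      -- fourth x-coordinate with the first.
      generic-product : ∀ {x y x′ y′ x″ y″} → Generic (x , y) (x′ , y′) → Generic (x′ , y′) (x″ , y″) →
        x″ * x′ * x ≈ - 1#
      generic-product {x} {y} {x′} {y′} {x″} (generic _ _ f) (generic x′≉0 e′ _) =
        *-cancelˡ x′≉0 (combine
          (solve 4 (λ x x′ y′ x″ →
            x′ :* (x″ :* x′ :* x) :- x′ :* :- :1
              := x :* (x″ :* x′ :^ 2 :- :- y′) :+ (:- :1) :* (y′ :* x :- x′))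
            refl x x′ y′ x″)
          (x ⊛ e′ ⊕ (- 1#) ⊛ f))

      generic-period : ∀ {x₀ y₀ x₁ y₁ x₂ y₂ x₃ y₃} → Generic (x₀ , y₀) (x₁ , y₁) →
        Generic (x₁ , y₁) (x₂ , y₂) → Generic (x₂ , y₂) (x₃ , y₃) → x₃ ≈ x₀ × y₃ ≈ y₀
      generic-period {x₀} {y₀} {x₁} {_} {x₂} {_} {x₃} {y₃}
        g₀@(generic _ e₀ _) g₁@(generic x₁≉0 _ _) g₂@(generic x₂≉0 _ f₂) = x₃≈x₀ ,
          -- Both `x₂ * y₃` and `x₂ * y₀` equal `x₀`, the latter by the product relation.
          *-cancelˡ x₂≉0 (combine
            (solve 6 (λ x₀ y₀ x₁ x₂ x₃ y₃ →
              x₂ :* y₃ :- x₂ :* y₀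
                := :1 :* (y₃ :* x₂ :- x₃) :+ :1 :* (x₃ :- x₀)
                   :+ x₀ :* (x₂ :* x₁ :* x₀ :- :- :1) :+ (:- x₂) :* (x₁ :* x₀ :^ 2 :- :- y₀))
              refl x₀ y₀ x₁ x₂ x₃ y₃)
            (1# ⊛ f₂ ⊕ 1# ⊛ x₃≈x₀ ⊕ x₀ ⊛ generic-product g₀ g₁ ⊕ (- x₂) ⊛ e₀))
        where
        x₃≈x₀ : x₃ ≈ x₀
        x₃≈x₀ = *-cancelˡ x₁≉0 (*-cancelˡ x₂≉0 (combine
          (solve 4 (λ x₀ x₁ x₂ x₃ →
            x₂ :* (x₁ :* x₃) :- x₂ :* (x₁ :* x₀)
              := :1 :* (x₃ :* x₂ :* x₁ :- :- :1) :+ (:- :1) :* (x₂ :* x₁ :* x₀ :- :- :1))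
            refl x₀ x₁ x₂ x₃)
          (1# ⊛ generic-product g₁ g₂ ⊕ (- 1#) ⊛ generic-product g₀ g₁)))

      period : ∀ {P Q R S} → Step P Q → Step Q R → Step R S → S ≈ᴾ P
      period (O↦T _ _) (T↦-T _ _ _ _) (-T↦O _ _) = nothing
      period (T↦-T p q _ _) (-T↦O _ _) (O↦T p′ q′) = just (trans p′ (sym p) , trans q′ (sym q))
      period (-T↦O p q) (O↦T _ _) (T↦-T _ _ p′ q′) = just (trans p′ (sym p) , trans q′ (sym q))
      period (other {P} {Q} g₀) (other {Q} g₁) (other g₂) = just (generic-period g₀ g₁ g₂)
      -- The remaining combinations would place one point in two of the disjoint cases.
      period (O↦T _ p) (-T↦O _ q) _ = contradiction q (0≉-1 p)
      period (O↦T p _) (other (generic x≉0 _ _)) _ = contradiction p x≉0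
      period (O↦T _ _) (T↦-T _ _ _ q) (T↦-T _ p _ _) = contradiction q (0≉-1 p)
      period (O↦T _ _) (T↦-T _ _ p _) (other (generic x≉0 _ _)) = contradiction p x≉0
      period (T↦-T _ _ _ q) (T↦-T _ p _ _) _ = contradiction q (0≉-1 p)
      period (T↦-T _ _ p _) (other (generic x≉0 _ _)) _ = contradiction p x≉0
      period (-T↦O _ _) (O↦T _ p) (-T↦O _ q) = contradiction q (0≉-1 p)
      period (-T↦O _ _) (O↦T p _) (other (generic x≉0 _ _)) = contradiction p x≉0
      period (other {P} g) (T↦-T p _ _ _) _ = contradiction p (generic-x′≉0 (proj₂ P) g)
      period (other {P} g) (-T↦O p _) _ = contradiction p (generic-x′≉0 (proj₂ P) g)
      period (other _) (other {Q} g) (T↦-T p _ _ _) = contradiction p (generic-x′≉0 (proj₂ Q) g)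
      period (other _) (other {Q} g) (-T↦O p _) = contradiction p (generic-x′≉0 (proj₂ Q) g)

      -- A generic fixed point has y = 1 from y x = x, then x³ = -1, so x = -1 by injectivity of
      -- cubing; the curve equation at (-1 , 1) says a = 3.
      free : ¬ a ≈ 3 · 1# → ∀ {P Q} → Step P Q → ¬ Q ≈ᴾ P
      free _ (T↦-T _ p _ q) (just (_ , e)) = 0≉-1 p (trans (sym e) q)
      free a≉3 (other {(x , y) , on} (generic x≉0 e f)) (just (p , q)) = a≉3 (combine
        (solve 3 (λ a x y →
          a :- 3 :· :1
            := (:- :1) :* (:lhs a x y :- :rhs x) :+ (y :+ 2 :· :1 :+ a :* x) :* (y :- :1)
               :+ a :* (x :- :- :1) :+ (:- :1) :* (x :^ 3 :- (:- :1) :^ 3))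
          refl a x y)
        (- 1# ⊛ on ⊕ (y + 2 · 1# + a * x) ⊛ y≈1 ⊕ a ⊛ ³-injective x³≈[-1]³ ⊕ (- 1#) ⊛ x³≈[-1]³))
        where
        y≈1 : y ≈ 1#
        y≈1 = *-cancelˡ x≉0 (trans (*-comm _ _) (trans (*-congʳ (sym q))
          (trans f (trans p (sym (*-identityʳ _))))))
        x³≈[-1]³ : x ^ 3 ≈ (- 1#) ^ 3
        x³≈[-1]³ = trans (*-congʳ (sym p)) (trans e (trans (-‿cong y≈1)
          (solve 0 (:- :1 := (:- :1) :^ 3) refl)))

    3∣#family : ¬ a ≈ 3 · 1# → ∃[ n ] (HasCardinality (points (family a)) n × 3 ∣ n)
    3∣#family a≉3 = proj₁ points-finite , proj₂ points-finite , Rotation.no-fixed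
      λ P → free a≉3 (proj₂ (total P))
      where
      module Rotation = Finite.OrderThree (proj₂ points-finite) (proj₁ ∘ total)
        (λ {P} {Q} P≈Q → unique P≈Q (proj₂ (total P)) (proj₂ (total Q)))
        (λ P → period (proj₂ (total P)) (proj₂ (total _)) (proj₂ (total _)))

  family-cong : ∀ {a a′} → a ≈ a′ → family a ≅ family a′
  family-cong {a} {a′} a≈a′ = 1# , 0# , 0# , 0# , 1#0 , mk≈ᵂ
    (combine (solve 2 (λ a a′ → :1 :* a′ :- (a :+ 2 :· :0) := (:- :1) :* (a :- a′)) refl a a′)
      (- 1# ⊛ a≈a′))
    (solve 1 (λ a → :1 :^ 2 :* :0 := :0 :- :0 :* a :+ 3 :· :0 :- :0 :^ 2) refl a)
    (solve 1 (λ a → :1 :^ 3 :* :1 := :1 :+ :0 :* a :+ 2 :· :0) refl a)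
    (solve 1 (λ a → :1 :^ 4 :* :0 := :0 :- :0 :* :1 :+ 2 :· (:0 :* :0) :- (:0 :+ :0 :* :0) :* a
      :+ 3 :· (:0 :^ 2) :- 2 :· (:0 :* :0)) refl a)
    (solve 1 (λ a → :1 :^ 6 :* :0 := :0 :+ :0 :* :0 :+ :0 :^ 2 :* :0 :+ :0 :^ 3 :- :0 :* :1
      :- :0 :^ 2 :- :0 :* :0 :* a) refl a)

  -- An isomorphism (u , r , s , t) carries the flex (0 , 0) to the flex
  -- (r , t).  On the flex tangent ℓ the equation y (y + a x + 1) = x³ becomes
  -- ℓ (ℓ + a x + 1) = x³ − (x − r)³, and as cubing is injective this
  -- forces r = 0.
  family-injective : ∀ {a a′} → family a ≅ family a′ → a ≈ a′
  family-injective {a} {a′} (u , r , s , t , _ , mk≈ᵂ p₁ p₂ p₃ p₄ p₆) = conclude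
    where
    q₂ : 3 · r - s * a - s ^ 2 ≈ 0#
    q₂ = trans (solve 3 (λ a r s → 3 :· r :- s :* a :- s :^ 2 := :0 :- s :* a :+ 3 :· r :- s :^ 2)
      refl a r s) (trans (sym p₂) (zeroʳ _))

    q₃ : u ^ 3 ≈ 1# + r * a + 2 · t
    q₃ = trans (sym (*-identityʳ _)) p₃

    q₄ : 3 · (r ^ 2) - s - (t + r * s) * a - 2 · (s * t) ≈ 0#
    q₄ = trans (solve 4 (λ a r s t →
        3 :· (r :^ 2) :- s :- (t :+ r :* s) :* a :- 2 :· (s :* t)
          := :0 :- s :* :1 :+ 2 :· (r :* :0) :- (t :+ r :* s) :* a :+ 3 :· (r :^ 2) :- 2 :· (s :* t))
      refl a r s t) (trans (sym p₄) (zeroʳ _))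

    q₆ : r ^ 3 - t - t ^ 2 - r * t * a ≈ 0#
    q₆ = trans (solve 3 (λ a r t →
        r :^ 3 :- t :- t :^ 2 :- r :* t :* a
          := :0 :+ r :* :0 :+ r :^ 2 :* :0 :+ r :^ 3 :- t :* :1 :- t :^ 2 :- r :* t :* a)
      refl a r t) (trans (sym p₆) (zeroʳ _))

    -- At the zero x = r - t/s of ℓ the cubes of x and x - r agree. Multiplied through by s³, this
    -- becomes an identity of cubes that is valid for s = 0 as well.
    t≈t-sr : t ≈ t - s * r
    t≈t-sr = ³-injective (combine
      (solve 4 (λ a r s t →
        t :^ 3 :- (t :- s :* r) :^ 3
          := s :* t :^ 2 :* (3 :· r :- s :* a :- s :^ 2 :- :0)
             :+ (:- (s :^ 2 :* t))
               :* (3 :· (r :^ 2) :- s :- (t :+ r :* s) :* a :- 2 :· (s :* t) :- :0)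
             :+ s :^ 3 :* (r :^ 3 :- t :- t :^ 2 :- r :* t :* a :- :0))
        refl a r s t)
      (s * t ^ 2 ⊛ q₂ ⊕ (- (s ^ 2 * t)) ⊛ q₄ ⊕ s ^ 3 ⊛ q₆))

    -- Now s r = 0, so r times `q₂` reduces to 3 r² = 0.
    r≈0 : r ≈ 0#
    r≈0 = x^n≈0⇒x≈0 2 (x*y≈0⇒y≈0 3≉0 (combine
      (solve 4 (λ a r s t →
        3 :· :1 :* r :^ 2 :- :0
          := r :* (3 :· r :- s :* a :- s :^ 2 :- :0) :+ (a :+ s) :* (t :- (t :- s :* r)))
        refl a r s t)
      (r ⊛ q₂ ⊕ (a + s) ⊛ t≈t-sr)))

    conclude : a ≈ a′
    -- With r = 0 the flex is (0 , 0) or (0 , -1). The first case forces the identity substitution,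
    -- the second the negation u = -1, s = -a, t = -1; both preserve a.
    conclude with t ≟ 0#
    ... | yes t≈0 = combine
      (solve 4 (λ a a′ u s →
        a :- a′ := (:- :1) :* (u :* a′ :- (a :+ 2 :· s)) :+ a′ :* (u :- :1)
                   :+ (:- (2 :· :1)) :* (s :- :0))
        refl a a′ u s)
      (- 1# ⊛ p₁ ⊕ a′ ⊛ u≈1 ⊕ (- (2 · 1#)) ⊛ s≈0)
      where
      u≈1 : u ≈ 1#
      u≈1 = ³-injective (combine
        (solve 4 (λ a u r t →
          u :^ 3 :- :1 :^ 3
            := :1 :* (u :^ 3 :- (:1 :+ r :* a :+ 2 :· t)) :+ a :* (r :- :0) :+ 2 :· :1 :* (t :- :0))
          refl a u r t)
        (1# ⊛ q₃ ⊕ a ⊛ r≈0 ⊕ 2 · 1# ⊛ t≈0))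

      s≈0 : s ≈ 0#
      s≈0 = combine
        (solve 4 (λ a r s t →
          s :- :0
            := (:- :1) :* (3 :· (r :^ 2) :- s :- (t :+ r :* s) :* a :- 2 :· (s :* t) :- :0)
               :+ (3 :· r :- s :* a) :* (r :- :0) :+ (:- (a :+ 2 :· s)) :* (t :- :0))
          refl a r s t)
        (- 1# ⊛ q₄ ⊕ (3 · r - s * a) ⊛ r≈0 ⊕ (- (a + 2 · s)) ⊛ t≈0)
    ... | no t≉0 = combine
      (solve 4 (λ a a′ u s →
        a :- a′ := :1 :* (u :* a′ :- (a :+ 2 :· s)) :+ (:- a′) :* (u :- :- :1)
                   :+ 2 :· :1 :* (s :- :- a))
        refl a a′ u s)
      (1# ⊛ p₁ ⊕ (- a′) ⊛ u≈-1 ⊕ 2 · 1# ⊛ s≈-a)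
      where
      t≈-1 : t ≈ - 1#
      t≈-1 = *-cancelˡ t≉0 (combine
        (solve 3 (λ a r t →
          t :* t :- t :* :- :1
            := (:- :1) :* (r :^ 3 :- t :- t :^ 2 :- r :* t :* a :- :0)
               :+ (r :^ 2 :- t :* a) :* (r :- :0))
          refl a r t)
        (- 1# ⊛ q₆ ⊕ (r ^ 2 - t * a) ⊛ r≈0))

      u≈-1 : u ≈ - 1#
      u≈-1 = ³-injective (combine
        (solve 4 (λ a u r t →
          u :^ 3 :- (:- :1) :^ 3
            := :1 :* (u :^ 3 :- (:1 :+ r :* a :+ 2 :· t)) :+ a :* (r :- :0)
               :+ 2 :· :1 :* (t :- :- :1))
          refl a u r t)
        (1# ⊛ q₃ ⊕ a ⊛ r≈0 ⊕ 2 · 1# ⊛ t≈-1))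

      s≈-a : s ≈ - a
      s≈-a = combine
        (solve 4 (λ a r s t →
          s :- :- a
            := :1 :* (3 :· (r :^ 2) :- s :- (t :+ r :* s) :* a :- 2 :· (s :* t) :- :0)
               :+ (s :* a :- 3 :· r) :* (r :- :0) :+ (a :+ 2 :· s) :* (t :- :- :1))
          refl a r s t)
        (1# ⊛ q₄ ⊕ (s * a - 3 · r) ⊛ r≈0 ⊕ (a + 2 · s) ⊛ t≈-1)

  -- The parametrization of the classes and their number.

  parametrization : Bijection (elementsApartFrom (3 · 1#)) (isomorphismClasses (OrderDivisibleBy 3))
  parametrization = record
    { to        = λ (a , a#3) → record { curve = family a
                                       ; discriminant# = ≉⇒# (discriminant-family≉0 (#⇒≉ a#3)) }
                                , 3∣#family a (#⇒≉ a#3)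
    ; cong      = family-cong
    ; bijective = family-injective , λ (E , n , cardᴾ , 3∣n) →
        let Δ≉0 = #⇒≉ (discriminant# E)
            P , on , flex = ChordTangent.Nonsingular.3∣#⇒flex F card (curve E) Δ≉0 cardᴾ 3∣n
            a , a≉3 , a≅E = flex⇒≅family (curve E) Δ≉0 on flex
        in (a , ≉⇒# a≉3) , λ {b} b≈a →
          Setoid.trans isoSetoid {family (proj₁ b)} {family a} {curve E} (family-cong b≈a) a≅E
    }

  classes-hasCardinality : HasCardinality (isomorphismClasses (OrderDivisibleBy 3)) (q ℕ.∸ 1)
  classes-hasCardinality =
    Composition.bijection (elementsApartFrom-hasCardinality (3 · 1#)) parametrization

open import Data.Nat using (_+_; _∸_)

proposition3 : ∀ {c ℓ₁ ℓ₂} (F : HeytingField c ℓ₁ ℓ₂) (q : ℕ) →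
    let module E = EllipticCurves F
        classes = E.isomorphismClasses (E.OrderDivisibleBy 3)
    in HasCardinality E.setoid q →
       3 ∣ q + 1 →
       HasCardinality classes (q ∸ 1) ×
       (Σ[ φ ∈ Bijection (E.elementsApartFrom (3 E.· E.1#)) classes ]
         (∀ a → E.EllipticCurve.curve (proj₁ (Bijection.to φ a)) ≡ E.family (proj₁ a)))
-- Repacking the bijections field by field keeps Agda from comparing the
-- equivalence proofs inside two copies of the setoid of classes.
proposition3 F q card 3∣q+1 = record { to = C.to ; cong = C.cong ; bijective = C.bijective }
  , record { to = P.to ; cong = λ {a} {b} → P.cong {a} {b} ; bijective = P.bijective }
  , λ _ → ≡.refl
  where
  module C = Bijection (Family.classes-hasCardinality F card 3∣q+1)
  module P = Bijection (Family.parametrization F card 3∣q+1)
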